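{- Weighted All-Or-One Paging with cache size $k$ has a deterministic $O(k)$-competitive online algorithm.
   Context: Weighted All-Or-One Paging with $k$ slots: each page $p$ has a weight $w(p)\ge 0$. Each request is either general, $(p,\ast)$, satisfied by a configuration holding page $p$ in any slot, or specific, $(p,j)$ with $j\in[k]$, satisfied only if slot $j$ holds $p$. A configuration assigns to each slot one page or nothing; a solution is a sequence of configurations satisfying the requests in order. Its cost is the sum, over all retrievals, of the weight of the retrieved page (page $p$ is retrieved in slot $s$ at time $t$ if $C_t$ assigns $p$ to $s$ but $C_{t-1}$ does not, or $t=1$). A deterministic online algorithm is $c$-competitive if its cost is at most $c\cdot\mathrm{OPT}(\sigma)+b$ for every request sequence $\sigma$, with $b$ a constant independent of $\sigma$.
   Formalization: The page weights w(p) are nonnegative rational numbers instead of nonnegative real numbers. -}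

module Defs where

open import Data.Nat as ℕ using (ℕ; zero; suc)
open import Data.Integer using (+_)
open import Data.Rational using (ℚ; 0ℚ; _+_; _*_; _≤_; _/_)
open import Data.Fin as Fin using (Fin)
open import Data.Maybe using (Maybe; just; nothing)
open import Data.List using (List; []; _∷_; _++_)
open import Data.List.Relation.Binary.Pointwise using (Pointwise)
open import Data.Product using (Σ; ∃; _×_; _,_)
open import Relation.Binary.PropositionalEquality using (_≡_)
open import Relation.Binary.Definitions using (DecidableEquality)
open import Relation.Nullary using (yes; no)

ℕtoℚ : ℕ → ℚ
ℕtoℚ n = (+ n) / 1

module AllOrOne (Page : Set) (_≟_ : DecidableEquality Page)
                (w : Page → ℚ) (k : ℕ) where

  Config : Set
  Config = Fin k → Maybe Page

  -- A request (p , nothing) is the general request (p,*);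
  -- (p , just j) is the specific request (p,j).
  Request : Set
  Request = Page × Maybe (Fin k)

  Satisfies : Config → Request → Set
  Satisfies C (p , nothing) = ∃ λ s → C s ≡ just p
  Satisfies C (p , just j)  = C j ≡ just p

  slotCost : Maybe Page → Maybe Page → ℚ
  slotCost old nothing = 0ℚ
  slotCost nothing (just p) = w p
  slotCost (just q) (just p) with q ≟ p
  ... | yes _ = 0ℚ
  ... | no  _ = w p

  sumFin : (n : ℕ) → (Fin n → ℚ) → ℚ
  sumFin zero    f = 0ℚ
  sumFin (suc n) f = f Fin.zero + sumFin n (λ i → f (Fin.suc i))

  stepCost : Config → Config → ℚ
  stepCost prev cur = sumFin k (λ s → slotCost (prev s) (cur s))

  emptyConfig : Config
  emptyConfig _ = nothing

  -- total cost of a sequence of configurations; at t = 1 every held page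
  -- counts as retrieved (previous configuration taken to be empty).
  costFrom : Config → List Config → ℚ
  costFrom prev []       = 0ℚ
  costFrom prev (C ∷ Cs) = stepCost prev C + costFrom C Cs

  cost : List Config → ℚ
  cost = costFrom emptyConfig

  IsSolution : List Request → List Config → Set
  IsSolution σ Cs = Pointwise (λ r C → Satisfies C r) σ Cs

  record OnlineAlg : Set where
    field
      step  : List Request → Request → Config
      valid : ∀ past r → Satisfies (step past r) r

  runFrom : OnlineAlg → List Request → List Request → List Config
  runFrom A past []      = []
  runFrom A past (r ∷ σ) = OnlineAlg.step A past r ∷ runFrom A (past ++ (r ∷ [])) σ

  run : OnlineAlg → List Request → List Config
  run A = runFrom A []

  -- c-competitive: cost(A,σ) ≤ c · OPT(σ) + b for all σ; stated as
  -- cost(A,σ) ≤ c · cost(S) + b for every feasible solution S of σ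
  -- (OPT is the minimum of cost(S) over feasible solutions).
  Competitive : ℚ → OnlineAlg → Set
  Competitive c A = Σ ℚ λ b → ∀ (σ : List Request) (S : List Config) →
    IsSolution σ S → cost (run A σ) ≤ c * cost S + b

{-# OPTIONS --safe #-}
-- The algorithm is a variant of Landlord. A retrieved page receives its weight
-- as credit. A general page q is put into a slot whose content is much lighter
-- than q; if no slot qualifies, the obstacles, one per slot, all pay the same
-- amount of credit until one of them is exhausted. When a specific request
-- expels a much heavier general page from a slot, the credit of that page stays
-- behind as a block, which keeps pages of similar weight out of the slot; this
-- stops cheap specific requests from chasing an expensive page around forever.
--
-- Against a solution with current configuration O, let T be the total credit
-- and Ψ the credit of the elements not covered by O, where a block is covered
-- while O holds only a much lighter page in that slot. Each slot of O covers at
-- most one obstacle, and the slot serving the request covers none, so a joint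
-- payment of δ lowers Ψ by at least δ and T by at most 10kδ. Hence T - 10kΨ
-- grows by at least a quarter of the cost of each retrieval, while a change of
-- O raises Ψ by O(1) times the weights moved, and T is O(k) times the largest
-- weight requested, which the solution has paid too.
module Submission where

open import Defs
open import Data.Nat as ℕ using (ℕ; zero; suc)
import Data.Nat.Properties as ℕ
open import Data.Nat.Induction using (<-wellFounded)
import Data.Integer as ℤ
import Data.Integer.Properties as ℤ
open import Data.Rational using (ℚ; 0ℚ; 1ℚ; _+_; _*_; _-_; -_; _≤_; _/_; toℚᵘ; *≤*; nonNegative)
open import Data.Rational.Properties using
  (≤-refl; ≤-reflexive; ≤-trans; ≤-antisym; ≤-total; <⇒≤; ≰⇒>; _≤?_; +-mono-≤; +-monoˡ-≤; +-monoʳ-≤;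
   +-assoc; +-identityˡ; +-identityʳ; +-inverseʳ; *-zeroˡ; *-zeroʳ; *-distribˡ-+; *-monoʳ-≤-nonNeg;
   toℚᵘ-injective; toℚᵘ-homo-+; toℚᵘ-fromℚᵘ)
import Data.Rational.Unnormalised as ℚᵘ
import Data.Rational.Unnormalised.Properties as ℚᵘ
open import Data.Rational.Solver using (module +-*-Solver)
open import Data.Fin as Fin using (Fin; zero; suc)
import Data.Fin.Properties as Fin
open import Data.List using (List; []; _∷_; length; filter; foldl; _++_)
open import Data.List.Properties using (foldl-++)
open import Data.List.Relation.Unary.All as All using (All; []; _∷_)
open import Data.List.Relation.Unary.All.Properties using (all-filter; ¬Any⇒All¬) renaming (filter⁺ to All-filter⁺)
open import Data.List.Relation.Unary.Any as Any using (Any; here; there)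
open import Data.List.Relation.Unary.Any.Properties using (lookup-result)
open import Data.List.Relation.Unary.AllPairs using (AllPairs; []; _∷_)
open import Data.List.Relation.Unary.AllPairs.Properties using () renaming (filter⁺ to AllPairs-filter⁺)
open import Data.List.Relation.Binary.Pointwise using ([]; _∷_)
open import Data.Maybe using (Maybe; just; nothing)
open import Data.Maybe.Properties using (just-injective; ≡-dec)
open import Data.Product using (Σ; ∃; _×_; _,_; proj₁; proj₂)
open import Data.Sum using (_⊎_; inj₁; inj₂; [_,_]′)
open import Data.Unit using (⊤; tt)
open import Data.Vec.Functional using (updateAt)
open import Data.Vec.Functional.Properties using (updateAt-updates; updateAt-minimal)
open import Function using (_∘_; const)
open import Induction.WellFounded using (Acc; acc)
open import Relation.Binary.Definitions using (DecidableEquality)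
open import Relation.Binary.PropositionalEquality
open import Relation.Nullary using (Dec; yes; no; ¬_; ¬?; contradiction; _×-dec_)
open import Relation.Unary using (Decidable)
open +-*-Solver using (solve; con; _:+_; _:*_; _:-_; _:=_)

-- Arithmetic of rational numbers

¼ 2ℚ 4ℚ 8ℚ 10ℚ 12ℚ 16ℚ 18ℚ 768ℚ : ℚ
¼ = ℤ.+ 1 / 4
2ℚ = ℕtoℚ 2
4ℚ = ℕtoℚ 4
8ℚ = ℕtoℚ 8
10ℚ = ℕtoℚ 10
12ℚ = ℕtoℚ 12
16ℚ = ℕtoℚ 16
18ℚ = ℕtoℚ 18
768ℚ = ℕtoℚ 768

private variable
  a b x y : ℚ

a≤b⇒0≤b-a : a ≤ b → 0ℚ ≤ b - a
a≤b⇒0≤b-a {a} {b} a≤b = subst (_≤ b - a) (+-inverseʳ a) (+-monoˡ-≤ (- a) a≤b)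

0≤+ : 0ℚ ≤ x → 0ℚ ≤ y → 0ℚ ≤ x + y
0≤+ 0≤x 0≤y = +-mono-≤ 0≤x 0≤y

0≤* : 0ℚ ≤ x → 0ℚ ≤ y → 0ℚ ≤ x * y
0≤* {x} {y} 0≤x 0≤y = subst (_≤ x * y) (*-zeroˡ y) (*-monoʳ-≤-nonNeg y {{nonNegative 0≤y}} 0≤x)

-- The form in which linear inequalities are proved: the gap is written as a sum of terms known to
-- be nonnegative, and the ring solver checks the identity.
≤-by-gap : 0ℚ ≤ x → b - a ≡ x → a ≤ b
≤-by-gap {x} {b} {a} 0≤x b-a≡x = subst₂ _≤_ (+-identityʳ a)
  (trans (cong (a +_) (sym b-a≡x)) (solve 2 (λ a b → a :+ (b :- a) := b) refl a b))
  (+-monoʳ-≤ a 0≤x)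

x≤x+y : 0ℚ ≤ y → x ≤ x + y
x≤x+y {y} {x} 0≤y = subst (_≤ x + y) (+-identityʳ x) (+-monoʳ-≤ x 0≤y)

x≤y+x : 0ℚ ≤ y → x ≤ y + x
x≤y+x {y} {x} 0≤y = subst (_≤ y + x) (+-identityˡ x) (+-monoˡ-≤ x 0≤y)

ℕtoℚ-suc : ∀ n → ℕtoℚ (suc n) ≡ 1ℚ + ℕtoℚ n
ℕtoℚ-suc n = toℚᵘ-injective (ℚᵘ.≃-trans (toℚᵘ-fromℚᵘ (ℚᵘ.mkℚᵘ (ℤ.+ suc n) 0))
  (ℚᵘ.≃-sym (ℚᵘ.≃-trans (toℚᵘ-homo-+ 1ℚ (ℕtoℚ n))
    (ℚᵘ.≃-trans (ℚᵘ.+-congʳ (toℚᵘ 1ℚ) (toℚᵘ-fromℚᵘ (ℚᵘ.mkℚᵘ (ℤ.+ n) 0)))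
      (ℚᵘ.*≡* (cong (ℤ._* ℤ.1ℤ) (cong (λ z → ℤ.1ℤ ℤ.+ z) (ℤ.*-identityʳ (ℤ.+ n)))))))))

0≤ℕtoℚ : ∀ n → 0ℚ ≤ ℕtoℚ n
0≤ℕtoℚ zero = ≤-refl
0≤ℕtoℚ (suc n) = subst (0ℚ ≤_) (sym (ℕtoℚ-suc n)) (0≤+ {1ℚ} (*≤* (ℤ.+≤+ ℕ.z≤n)) (0≤ℕtoℚ n))

1≤ℕtoℚ : ∀ {n} → 1 ℕ.≤ n → 1ℚ ≤ ℕtoℚ n
1≤ℕtoℚ {suc n} _ = subst (1ℚ ≤_) (sym (ℕtoℚ-suc n)) (x≤x+y {ℕtoℚ n} {1ℚ} (0≤ℕtoℚ n))

ℕtoℚ-+ : ∀ m n → ℕtoℚ (m ℕ.+ n) ≡ ℕtoℚ m + ℕtoℚ n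
ℕtoℚ-+ zero n = sym (+-identityˡ (ℕtoℚ n))
ℕtoℚ-+ (suc m) n rewrite ℕtoℚ-suc (m ℕ.+ n) | ℕtoℚ-suc m | ℕtoℚ-+ m n =
  solve 3 (λ o a b → o :+ (a :+ b) := o :+ a :+ b) refl 1ℚ (ℕtoℚ m) (ℕtoℚ n)

ℕtoℚ-* : ∀ m n → ℕtoℚ (m ℕ.* n) ≡ ℕtoℚ m * ℕtoℚ n
ℕtoℚ-* zero n = sym (*-zeroˡ (ℕtoℚ n))
ℕtoℚ-* (suc m) n rewrite ℕtoℚ-+ n (m ℕ.* n) | ℕtoℚ-suc m | ℕtoℚ-* m n =
  solve 2 (λ a b → b :+ a :* b := (con 1ℚ :+ a) :* b) refl (ℕtoℚ m) (ℕtoℚ n)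

0≤¼ : 0ℚ ≤ ¼
0≤¼ = *≤* (ℤ.+≤+ ℕ.z≤n)

0≤10ℚ : 0ℚ ≤ 10ℚ
0≤10ℚ = 0≤ℕtoℚ 10

¼*≤ : ∀ {x} → 0ℚ ≤ x → ¼ * x ≤ x
¼*≤ {x} 0≤x = ≤-by-gap (0≤* {ℕtoℚ 3 * ¼} (0≤* {ℕtoℚ 3} {¼} (0≤ℕtoℚ 3) 0≤¼) 0≤x)
  (solve 1 (λ x → x :- con ¼ :* x := con (ℕtoℚ 3) :* con ¼ :* x) refl x)

¼*-mono : ∀ {x y} → x ≤ y → ¼ * x ≤ ¼ * y
¼*-mono {x} {y} x≤y = ≤-by-gap (0≤* {¼} 0≤¼ (a≤b⇒0≤b-a x≤y))
  (solve 2 (λ x y → con ¼ :* y :- con ¼ :* x := con ¼ :* (y :- x)) refl x y)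

-- Minimum and search over finite index sets

argmin : ∀ {n} → 1 ℕ.≤ n → (f : Fin n → ℚ) → ∃ λ j → ∀ i → f j ≤ f i
argmin {suc zero} _ f = zero , λ { zero → ≤-refl }
argmin {suc (suc n)} _ f with argmin {suc n} (ℕ.s≤s ℕ.z≤n) (f ∘ suc)
... | j , min with ≤-total (f zero) (f (suc j))
... | inj₁ f0≤fj = zero , λ { zero → ≤-refl ; (suc i) → ≤-trans f0≤fj (min i) }
... | inj₂ fj≤f0 = suc j , λ { zero → fj≤f0 ; (suc i) → min i }

search : ∀ {n} {P Q : Fin n → Set} → (∀ i → P i ⊎ Q i) → ∃ P ⊎ (∀ i → Q i)
search {zero} _ = inj₂ λ ()
search {suc n} P⊎Q with P⊎Q zero | search (P⊎Q ∘ suc)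
... | inj₁ p | _ = inj₁ (zero , p)
... | inj₂ q | inj₁ (i , p) = inj₁ (suc i , p)
... | inj₂ q | inj₂ qs = inj₂ λ { zero → q ; (suc i) → qs i }

-- Finite sums

module Sums (Page : Set) (_≟_ : DecidableEquality Page) (w : Page → ℚ) (k : ℕ) where

  open AllOrOne Page _≟_ w k using (sumFin)

  sum-mono : ∀ {n} {f g : Fin n → ℚ} → (∀ i → f i ≤ g i) → sumFin n f ≤ sumFin n g
  sum-mono {zero} f≤g = ≤-refl
  sum-mono {suc n} f≤g = +-mono-≤ (f≤g zero) (sum-mono (f≤g ∘ suc))

  sum-cong : ∀ {n} {f g : Fin n → ℚ} → (∀ i → f i ≡ g i) → sumFin n f ≡ sumFin n g
  sum-cong {zero} f≡g = refl
  sum-cong {suc n} f≡g = cong₂ _+_ (f≡g zero) (sum-cong (f≡g ∘ suc))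

  sum-+ : ∀ {n} (f g : Fin n → ℚ) → sumFin n (λ i → f i + g i) ≡ sumFin n f + sumFin n g
  sum-+ {zero} f g = refl
  sum-+ {suc n} f g rewrite sum-+ (f ∘ suc) (g ∘ suc) =
    solve 4 (λ a b c d → a :+ b :+ (c :+ d) := a :+ c :+ (b :+ d)) refl
      (f zero) (g zero) (sumFin n (f ∘ suc)) (sumFin n (g ∘ suc))

  sum-* : ∀ {n} c (f : Fin n → ℚ) → sumFin n (λ i → c * f i) ≡ c * sumFin n f
  sum-* {zero} c f = sym (*-zeroʳ c)
  sum-* {suc n} c f rewrite sum-* c (f ∘ suc) = sym (*-distribˡ-+ c (f zero) (sumFin n (f ∘ suc)))

  sum-const : ∀ n c → sumFin n (λ _ → c) ≡ ℕtoℚ n * c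
  sum-const zero c = sym (*-zeroˡ c)
  sum-const (suc n) c rewrite sum-const n c | ℕtoℚ-suc n =
    solve 2 (λ n c → c :+ n :* c := (con 1ℚ :+ n) :* c) refl (ℕtoℚ n) c

  sum-0 : ∀ n → sumFin n (λ _ → 0ℚ) ≡ 0ℚ
  sum-0 zero = refl
  sum-0 (suc n) rewrite sum-0 n = refl

  sum-nonneg : ∀ {n} {f : Fin n → ℚ} → (∀ i → 0ℚ ≤ f i) → 0ℚ ≤ sumFin n f
  sum-nonneg {n} {f} 0≤f = subst (_≤ sumFin n f) (sum-0 n) (sum-mono 0≤f)

  term≤sum : ∀ {n} {f : Fin n → ℚ} → (∀ i → 0ℚ ≤ f i) → ∀ i → f i ≤ sumFin n f
  term≤sum 0≤f zero = x≤x+y (sum-nonneg (0≤f ∘ suc))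
  term≤sum 0≤f (suc i) = ≤-trans (term≤sum (0≤f ∘ suc) i) (x≤y+x (0≤f zero))

  sum-swap : ∀ {m n} (f : Fin m → Fin n → ℚ) →
    sumFin m (λ i → sumFin n (f i)) ≡ sumFin n (λ j → sumFin m (λ i → f i j))
  sum-swap {zero} {n} f = sym (sum-0 n)
  sum-swap {suc m} {n} f rewrite sum-swap (f ∘ suc) =
    sym (sum-+ (f zero) (λ j → sumFin m (λ i → f (suc i) j)))

  -- A request produces its gain in a single slot while the others do not get worse; the slack `d`
  -- is therefore asked of one term only.
  sum-gain : ∀ {n} {f g : Fin n → ℚ} {d} (j : Fin n) → (∀ i → i ≢ j → f i ≤ g i) →
    f j + d ≤ g j → sumFin n f + d ≤ sumFin n g
  sum-gain {suc n} {f} {g} {d} zero f≤g gain =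
    subst (_≤ sumFin (suc n) g)
      (solve 3 (λ a b d → a :+ d :+ b := a :+ b :+ d) refl (f zero) (sumFin n (f ∘ suc)) d)
      (+-mono-≤ gain (sum-mono (λ i → f≤g (suc i) λ ())))
  sum-gain {suc n} {f} {g} {d} (suc j) f≤g gain =
    subst (_≤ sumFin (suc n) g)
      (solve 3 (λ a b d → a :+ (b :+ d) := a :+ b :+ d) refl (f zero) (sumFin n (f ∘ suc)) d)
      (+-mono-≤ (f≤g zero λ ()) (sum-gain j (λ i i≢j → f≤g (suc i) (λ { refl → i≢j refl })) gain))

  sum-single : ∀ {n} {f : Fin n → ℚ} {b} (j : Fin n) → (∀ i → i ≢ j → f i ≤ 0ℚ) →
    f j ≤ b → sumFin n f ≤ b
  sum-single {n} {f} {b} j f≤0 fj≤b = ≤-by-gap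
    (a≤b⇒0≤b-a (subst (sumFin n f - b ≤_) (sum-0 n)
      (sum-gain {d = - b} j f≤0 (subst (f j - b ≤_) (+-inverseʳ b) (+-monoˡ-≤ (- b) fj≤b)))))
    (solve 2 (λ s b → b :- s := con 0ℚ :- (s :- b)) refl (sumFin n f) b)

-- Values counted under a decidable condition

unless : ∀ {P : Set} → Dec P → ℚ → ℚ
unless (yes _) c = 0ℚ
unless (no _)  c = c

when : ∀ {P : Set} → Dec P → ℚ → ℚ
when (yes _) c = c
when (no _)  c = 0ℚ

when-nonneg : ∀ {P : Set} (d : Dec P) {c} → 0ℚ ≤ c → 0ℚ ≤ when d c
when-nonneg (yes _) 0≤c = 0≤c
when-nonneg (no _)  0≤c = ≤-refl

unless-nonneg : ∀ {P : Set} (d : Dec P) {c} → 0ℚ ≤ c → 0ℚ ≤ unless d c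
unless-nonneg (yes _) 0≤c = ≤-refl
unless-nonneg (no _)  0≤c = 0≤c

unless-¬? : ∀ {P : Set} (d : Dec P) c → unless (¬? d) c ≡ when d c
unless-¬? (yes _) c = refl
unless-¬? (no _)  c = refl

unless-pay : ∀ {P : Set} (d : Dec P) c δ s → unless d (c - δ) + s + unless d δ ≡ unless d c + s
unless-pay (yes _) c δ s = +-identityʳ _
unless-pay (no _)  c δ s = solve 3 (λ c δ s → (c :- δ) :+ s :+ δ := c :+ s) refl c δ s

-- The algorithm: slots, obstacles and payments

module Landlord (Page : Set) (_≟_ : DecidableEquality Page) (w : Page → ℚ)
                (k : ℕ) (1≤k : 1 ℕ.≤ k) where

  open AllOrOne Page _≟_ w k

  -- The tag records which kind of request brought the page in. A `spec` page is covered only by the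
  -- same slot of the solution, a `gen` page by any slot. The number is the remaining credit.
  data Content : Set where
    empty    : Content
    gen spec : (p : Page) (c : ℚ) → Content

  Block : Set
  Block = Page × ℚ

  infix 4 _▹_
  record Slot : Set where
    constructor _▹_
    field
      content : Content
      blocks  : List Block
  open Slot public

  State : Set
  State = Fin k → Slot

  held : Content → Maybe Page
  held empty      = nothing
  held (gen p c)  = just p
  held (spec p c) = just p

  config : State → Config
  config s j = held (content (s j))

  -- The factor 4 leaves room for the credit that `q` destroys in its slot; the factor 2 keeps the
  -- weights doubling from a general page to the blocks of its slot. `Clash` is the range in
  -- between.
  Light Heavy Clash : Page → Page → Set
  Light q p = w p ≤ ¼ * w q
  Heavy q p = 2ℚ * w q ≤ w p
  Clash q p = ¬ Light q p × ¬ Heavy q p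

  light? : ∀ q p → Dec (Light q p)
  light? q p = w p ≤? ¼ * w q

  heavy? : ∀ q p → Dec (Heavy q p)
  heavy? q p = 2ℚ * w q ≤? w p

  clash? : ∀ q p → Dec (Clash q p)
  clash? q p = ¬? (light? q p) ×-dec ¬? (heavy? q p)

  data Obstacle (q : Page) : Slot → Set where
    byGen   : ∀ {p c bs} → ¬ Light q p → Obstacle q (gen p c ▹ bs)
    bySpec  : ∀ {p c bs} → ¬ (10ℚ * w p ≤ ¼ * w q) → Obstacle q (spec p c ▹ bs)
    byBlock : ∀ {ct bs} → Any (Clash q ∘ proj₁) bs → Obstacle q (ct ▹ bs)

  -- A specific page has to be lighter by a further factor 10, since its credit counts tenfold in
  -- `T`.
  Displaceable : Page → Content → Set
  Displaceable q empty      = ⊤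
  Displaceable q (gen p c)  = Light q p
  Displaceable q (spec p c) = 10ℚ * w p ≤ ¼ * w q

  Free : Page → Slot → Set
  Free q sl = Displaceable q (content sl) × All (¬_ ∘ Clash q ∘ proj₁) (blocks sl)

  free⊎obstacle : ∀ q sl → Free q sl ⊎ Obstacle q sl
  free⊎obstacle q (ct ▹ bs) with Any.any? (clash? q ∘ proj₁) bs
  ... | yes clash = inj₂ (byBlock clash)
  free⊎obstacle q (empty ▹ bs) | no free = inj₁ (tt , ¬Any⇒All¬ bs free)
  free⊎obstacle q (gen p c ▹ bs) | no free with light? q p
  ... | yes light = inj₁ (light , ¬Any⇒All¬ bs free)
  ... | no ¬light = inj₂ (byGen ¬light)
  free⊎obstacle q (spec p c ▹ bs) | no free with 10ℚ * w p ≤? ¼ * w q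
  ... | yes light = inj₁ (light , ¬Any⇒All¬ bs free)
  ... | no ¬light = inj₂ (bySpec ¬light)

  credit : ∀ {q sl} → Obstacle q sl → ℚ
  credit (byGen {c = c} _)  = c
  credit (bySpec {c = c} _) = c
  credit (byBlock i)        = proj₂ (Any.lookup i)

  payBlock : ∀ {P : Block → Set} {bs} → ℚ → Any P bs → List Block
  payBlock {bs = (p , c) ∷ bs} δ (here _) with c ≤? δ
  ... | yes _ = bs
  ... | no  _ = (p , c - δ) ∷ bs
  payBlock {bs = b ∷ bs} δ (there i) = b ∷ payBlock δ i

  emptyIf : ∀ {P : Set} → Dec P → Content → Content
  emptyIf (yes _) ct = empty
  emptyIf (no _)  ct = ct

  pay : ∀ {q sl} → ℚ → Obstacle q sl → Slot
  pay δ (byGen {p} {c} {bs} _)  = emptyIf (c ≤? δ) (gen p (c - δ)) ▹ bs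
  pay δ (bySpec {p} {c} {bs} _) = emptyIf (c ≤? δ) (spec p (c - δ)) ▹ bs
  pay δ (byBlock {ct} i) = ct ▹ payBlock δ i

  -- In a free slot the blocks discarded here are light, and under the invariant their credit is at
  -- most half of `w q`.
  occupy : Page → Slot → Slot
  occupy q (ct ▹ bs) = gen q (w q) ▹ filter (heavy? q ∘ proj₁) bs

  -- Placement is recorded as a derivation, so that the analysis is an induction on it. Taking the
  -- least credit as the payment makes it affordable to every obstacle.
  data Place (q : Page) : State → State → Set where
    insert : ∀ {s} j → Free q (s j) → Place q s (updateAt s j (occupy q))
    charge : ∀ {s s′} (o : ∀ j → Obstacle q (s j)) j →
             (∀ i → credit (o j) ≤ credit (o i)) →
             Place q (λ i → pay (credit (o j)) (o i)) s′ → Place q s s′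

  -- Termination of the placement

  contentSize : Content → ℕ
  contentSize empty = 0
  contentSize (gen _ _) = 1
  contentSize (spec _ _) = 1

  slotSize : Slot → ℕ
  slotSize (ct ▹ bs) = contentSize ct ℕ.+ length bs

  payBlock-size : ∀ {P : Block → Set} {bs} δ (i : Any P bs) → length (payBlock δ i) ℕ.≤ length bs
  payBlock-size {bs = (p , c) ∷ bs} δ (here _) with c ≤? δ
  ... | yes _ = ℕ.n≤1+n _
  ... | no  _ = ℕ.≤-refl
  payBlock-size δ (there i) = ℕ.s≤s (payBlock-size δ i)

  payBlock-size< : ∀ {P : Block → Set} {bs} (i : Any P bs) → length (payBlock (proj₂ (Any.lookup i)) i) ℕ.< length bs
  payBlock-size< {bs = (p , c) ∷ bs} (here _) with c ≤? c
  ... | yes _ = ℕ.≤-refl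
  ... | no c≰c = contradiction ≤-refl c≰c
  payBlock-size< (there i) = ℕ.s≤s (payBlock-size< i)

  pay-size : ∀ {q sl} δ (o : Obstacle q sl) → slotSize (pay δ o) ℕ.≤ slotSize sl
  pay-size δ (byGen {c = c} _) with c ≤? δ
  ... | yes _ = ℕ.n≤1+n _
  ... | no  _ = ℕ.≤-refl
  pay-size δ (bySpec {c = c} _) with c ≤? δ
  ... | yes _ = ℕ.n≤1+n _
  ... | no  _ = ℕ.≤-refl
  pay-size δ (byBlock {ct} i) = ℕ.+-monoʳ-≤ (contentSize ct) (payBlock-size δ i)

  pay-size< : ∀ {q sl} (o : Obstacle q sl) → slotSize (pay (credit o) o) ℕ.< slotSize sl
  pay-size< (byGen {c = c} _) with c ≤? c
  ... | yes _ = ℕ.≤-refl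
  ... | no c≰c = contradiction ≤-refl c≰c
  pay-size< (bySpec {c = c} _) with c ≤? c
  ... | yes _ = ℕ.≤-refl
  ... | no c≰c = contradiction ≤-refl c≰c
  pay-size< (byBlock {ct} i) = ℕ.+-monoʳ-< (contentSize ct) (payBlock-size< i)

  size : ∀ {n} → (Fin n → Slot) → ℕ
  size {zero}  s = 0
  size {suc n} s = slotSize (s zero) ℕ.+ size (s ∘ suc)

  size-mono-≤ : ∀ {n} {s t : Fin n → Slot} → (∀ i → slotSize (s i) ℕ.≤ slotSize (t i)) → size s ℕ.≤ size t
  size-mono-≤ {zero}  s≤t = ℕ.z≤n
  size-mono-≤ {suc n} s≤t = ℕ.+-mono-≤ (s≤t zero) (size-mono-≤ (s≤t ∘ suc))

  size-mono-< : ∀ {n} {s t : Fin n → Slot} j → (∀ i → slotSize (s i) ℕ.≤ slotSize (t i)) →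
    slotSize (s j) ℕ.< slotSize (t j) → size s ℕ.< size t
  size-mono-< zero    s≤t sj<tj = ℕ.+-mono-<-≤ sj<tj (size-mono-≤ (s≤t ∘ suc))
  size-mono-< (suc j) s≤t sj<tj = ℕ.+-mono-≤-< (s≤t zero) (size-mono-< j (s≤t ∘ suc) sj<tj)

  place : ∀ q s → Acc ℕ._<_ (size s) → ∃ (Place q s)
  place q s (acc rec) with search (λ j → free⊎obstacle q (s j))
  ... | inj₁ (j , free) = _ , insert j free
  ... | inj₂ o with argmin 1≤k (credit ∘ o)
  -- The obstacle of least credit is exhausted by the payment and disappears, so the number of pages
  -- and blocks drops.
  ... | j , min with place q (λ i → pay (credit (o j)) (o i))
                     (rec (size-mono-< j (λ i → pay-size (credit (o j)) (o i)) (pay-size< (o j))))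
  ... | s′ , placed = s′ , charge o j min placed

  -- Serving a request

  evictGen : Page → Slot → Slot
  evictGen p (gen g c ▹ bs) with g ≟ p
  ... | yes _ = empty ▹ bs
  ... | no  _ = gen g c ▹ bs
  evictGen p sl = sl

  -- A general page of weight up to `8ℚ * w p` is dropped with its credit, a loss for which the
  -- tenfold credit of `p` makes up. A heavier one leaves its credit as a block, which is covered
  -- while the solution has `p` in this slot.
  install : Page → Slot → Slot
  install p (gen g c ▹ bs) with w g ≤? 8ℚ * w p
  ... | yes _ = spec p (w p) ▹ bs
  ... | no  _ = spec p (w p) ▹ (g , c) ∷ bs
  install p (ct ▹ bs) = spec p (w p) ▹ bs

  -- General copies of `p` in other slots are removed to maintain `Unique`; specific copies may
  -- remain.
  force : Page → Fin k → State → State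
  force p j s i with i Fin.≟ j
  ... | yes _ = install p (s i)
  ... | no  _ = evictGen p (s i)

  force-at : ∀ p j s → force p j s j ≡ install p (s j)
  force-at p j s with j Fin.≟ j
  ... | yes _ = refl
  ... | no j≢j = contradiction refl j≢j

  force-off : ∀ p {j} s {i} → i ≢ j → force p j s i ≡ evictGen p (s i)
  force-off p {j} s {i} i≢j with i Fin.≟ j
  ... | yes i≡j = contradiction i≡j i≢j
  ... | no _ = refl

  data Handled (s : State) : Request → State → Set where
    hit    : ∀ {r} → Satisfies (config s) r → Handled s r s
    forced : ∀ {p j} → ¬ Satisfies (config s) (p , just j) → Handled s (p , just j) (force p j s)
    placed : ∀ {p s′} → ¬ Satisfies (config s) (p , nothing) → Place p s s′ → Handled s (p , nothing) s′

  _≟ᴹ_ : DecidableEquality (Maybe Page)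
  _≟ᴹ_ = ≡-dec _≟_

  satisfies? : ∀ C r → Dec (Satisfies C r)
  satisfies? C (p , nothing) = Fin.any? (λ i → C i ≟ᴹ just p)
  satisfies? C (p , just j)  = C j ≟ᴹ just p

  handle : ∀ s r → ∃ (Handled s r)
  handle s r with satisfies? (config s) r
  ... | yes sat = s , hit sat
  handle s (p , just j)  | no unsat = force p j s , forced unsat
  handle s (p , nothing) | no unsat with place p s (<-wellFounded (size s))
  ... | s′ , pl = s′ , placed unsat pl

  -- Effect of a request on the configuration

  held-install : ∀ p sl → held (content (install p sl)) ≡ just p
  held-install p (empty ▹ bs) = refl
  held-install p (spec _ _ ▹ bs) = refl
  held-install p (gen g c ▹ bs) with w g ≤? 8ℚ * w p
  ... | yes _ = refl
  ... | no  _ = refl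

  held-evictGen : ∀ p sl →
    held (content (evictGen p sl)) ≡ nothing ⊎ held (content (evictGen p sl)) ≡ held (content sl)
  held-evictGen p (empty ▹ bs) = inj₂ refl
  held-evictGen p (spec _ _ ▹ bs) = inj₂ refl
  held-evictGen p (gen g c ▹ bs) with g ≟ p
  ... | yes _ = inj₁ refl
  ... | no  _ = inj₂ refl

  held-pay : ∀ {q sl} δ (o : Obstacle q sl) →
    held (content (pay δ o)) ≡ nothing ⊎ held (content (pay δ o)) ≡ held (content sl)
  held-pay δ (byGen {c = c} _) with c ≤? δ
  ... | yes _ = inj₁ refl
  ... | no  _ = inj₂ refl
  held-pay δ (bySpec {c = c} _) with c ≤? δ
  ... | yes _ = inj₁ refl
  ... | no  _ = inj₂ refl
  held-pay δ (byBlock _) = inj₂ refl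

  -- All that feasibility and cost need to know of a step that is not a hit: only slot `j` can incur
  -- a retrieval.
  record Fetches (p : Page) (j : Fin k) (C C′ : Config) : Set where
    field
      there-now : C′ j ≡ just p
      elsewhere : ∀ i → i ≢ j → C′ i ≡ nothing ⊎ C′ i ≡ C i

  force-fetches : ∀ p j s → Fetches p j (config s) (config (force p j s))
  force-fetches p j s = record
    { there-now = trans (cong (held ∘ content) (force-at p j s)) (held-install p (s j))
    ; elsewhere = λ i i≢j → subst (λ sl → held (content sl) ≡ nothing ⊎ held (content sl) ≡ config s i)
        (sym (force-off p s i≢j)) (held-evictGen p (s i)) }

  place-fetches : ∀ {q s s′} → Place q s s′ → ∃ λ j → Fetches q j (config s) (config s′)
  place-fetches {q} (insert {s} j _) = j , record
    { there-now = cong (held ∘ content) (updateAt-updates j s)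
    ; elsewhere = λ i i≢j → inj₂ (cong (held ∘ content) (updateAt-minimal i j s i≢j)) }
  place-fetches {q} (charge {s} {s′} o j₀ _ pl) with place-fetches pl
  ... | j , f = j , record
    { there-now = Fetches.there-now f
    ; elsewhere = λ i i≢j → [ inj₁ , later i ]′ (Fetches.elsewhere f i i≢j) }
    where
    later : ∀ i → config s′ i ≡ held (content (pay (credit (o j₀)) (o i))) →
      config s′ i ≡ nothing ⊎ config s′ i ≡ config s i
    later i eq with held-pay (credit (o j₀)) (o i)
    ... | inj₁ gone = inj₁ (trans eq gone)
    ... | inj₂ same = inj₂ (trans eq same)

  handled-satisfies : ∀ {s r s′} → Handled s r s′ → Satisfies (config s′) r
  handled-satisfies (hit sat) = sat
  handled-satisfies {s} (forced {p} {j} _) = Fetches.there-now (force-fetches p j s)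
  handled-satisfies (placed _ pl) with place-fetches pl
  ... | j , f = j , Fetches.there-now f

  -- The online algorithm

  next : State → Request → State
  next s r = proj₁ (handle s r)

  initial : State
  initial _ = empty ▹ []

  after : List Request → State
  after = foldl next initial

  landlord : OnlineAlg
  landlord = record
    -- An `OnlineAlg` carries no memory, so the state is recomputed from the past requests.
    { step  = λ past r → config (next (after past) r)
    ; valid = λ past r → handled-satisfies (proj₂ (handle (after past) r)) }

-- Competitive analysis: invariants of the state

module Analysis (Page : Set) (_≟_ : DecidableEquality Page) (w : Page → ℚ)
                 (0≤w : ∀ p → 0ℚ ≤ w p) (k : ℕ) (1≤k : 1 ℕ.≤ k) where

  open AllOrOne Page _≟_ w k
  open Sums Page _≟_ w k
  open Landlord Page _≟_ w k 1≤k

  wᴹ : Maybe Page → ℚ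
  wᴹ nothing  = 0ℚ
  wᴹ (just p) = w p

  0≤wᴹ : ∀ x → 0ℚ ≤ wᴹ x
  0≤wᴹ nothing  = ≤-refl
  0≤wᴹ (just p) = 0≤w p

  sumWhere : {P : Page → Set} → Decidable P → List Block → ℚ
  sumWhere P? [] = 0ℚ
  sumWhere P? ((p , c) ∷ bs) = when (P? p) c + sumWhere P? bs

  total : List Block → ℚ
  total = sumWhere {P = const ⊤} (λ _ → yes tt)

  -- `m` bounds the weights requested so far; the cost already paid by the solution will serve as
  -- such a bound.
  record Priced (m : ℚ) (b : Block) : Set where
    constructor priced
    field
      nonneg  : 0ℚ ≤ proj₂ b
      bounded : proj₂ b ≤ w (proj₁ b)
      known   : w (proj₁ b) ≤ m

  Doubling : Block → Block → Set
  Doubling b b′ = 2ℚ * w (proj₁ b) ≤ w (proj₁ b′)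

  -- A general page has to continue the doubling chain of the blocks because it may become a block
  -- itself; a specific page never does.
  ContentOK : ℚ → Slot → Set
  ContentOK m (empty ▹ bs)    = ⊤
  ContentOK m (gen p c ▹ bs)  = Priced m (p , c) × All (Doubling (p , c)) bs
  ContentOK m (spec p c ▹ bs) = Priced m (p , c)

  record SlotOK (m : ℚ) (sl : Slot) : Set where
    constructor slotOK
    field
      contentOK : ContentOK m sl
      blocksOK  : All (Priced m) (blocks sl)
      doubling  : AllPairs Doubling (blocks sl)
  open SlotOK

  -- A general page has no second copy of either kind, while specific copies of one page may sit in
  -- several slots. Hence a page in one slot of the solution does not cover two page obstacles.
  Unique : State → Set
  Unique s = ∀ {i j p c} → content (s i) ≡ gen p c → held (content (s j)) ≡ just p → i ≡ j

  record Inv (m : ℚ) (s : State) : Set where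
    constructor inv
    field
      slots  : ∀ j → SlotOK m (s j)
      unique : Unique s
  open Inv

  -- Sums over the blocks of a slot

  sumWhere-nonneg : ∀ {P : Page → Set} (P? : Decidable P) {m bs} → All (Priced m) bs → 0ℚ ≤ sumWhere P? bs
  sumWhere-nonneg P? [] = ≤-refl
  sumWhere-nonneg P? (pr ∷ prs) = 0≤+ (when-nonneg (P? _) (Priced.nonneg pr)) (sumWhere-nonneg P? prs)

  -- The weights of the blocks of a slot at least double from one to the next,
  -- so those of weight at most x add up to at most 2x.
  sumWhere-geometric : ∀ {P : Page → Set} (P? : Decidable P) {m x f bs} → All (Priced m) bs →
    AllPairs Doubling bs → All (λ b → 2ℚ * f ≤ w (proj₁ b)) bs → f ≤ x →
    (∀ {p} → P p → w p ≤ x) → 2ℚ * f + sumWhere P? bs ≤ 2ℚ * x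
  sumWhere-geometric P? {x = x} {f} [] [] [] f≤x P≤x = ≤-by-gap
    (0≤+ (a≤b⇒0≤b-a f≤x) (a≤b⇒0≤b-a f≤x))
    (solve 2 (λ f x → con 2ℚ :* x :- (con 2ℚ :* f :+ con 0ℚ) := (x :- f) :+ (x :- f)) refl f x)
  sumWhere-geometric P? {x = x} {f} {(p , c) ∷ bs} (pr ∷ prs) (dbl ∷ dbls) (2f≤p ∷ 2f≤bs) f≤x P≤x with P? p
  ... | yes Pp = ≤-by-gap
    (0≤+ (0≤+ (a≤b⇒0≤b-a (sumWhere-geometric P? prs dbls dbl (P≤x Pp) P≤x)) (a≤b⇒0≤b-a 2f≤p))
      (a≤b⇒0≤b-a (Priced.bounded pr)))
    (solve 5 (λ f x c s p → con 2ℚ :* x :- (con 2ℚ :* f :+ (c :+ s)) :=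
        (con 2ℚ :* x :- (con 2ℚ :* p :+ s)) :+ (p :- con 2ℚ :* f) :+ (p :- c)) refl
      f x c (sumWhere P? bs) (w p))
  ... | no _ = subst (λ z → 2ℚ * f + z ≤ 2ℚ * x) (sym (+-identityˡ (sumWhere P? bs)))
    (sumWhere-geometric P? prs dbls 2f≤bs f≤x P≤x)

  sumWhere-≤2x : ∀ {P : Page → Set} (P? : Decidable P) {m x bs} → All (Priced m) bs →
    AllPairs Doubling bs → 0ℚ ≤ x → (∀ {p} → P p → w p ≤ x) → sumWhere P? bs ≤ 2ℚ * x
  sumWhere-≤2x P? {x = x} {bs} prs dbls 0≤x P≤x =
    subst (_≤ 2ℚ * x) (+-identityˡ (sumWhere P? bs))
      (sumWhere-geometric P? {f = 0ℚ} prs dbls (All.map (λ _ → 0≤w _) prs) 0≤x P≤x)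

  total-≤2m : ∀ {m bs} → 0ℚ ≤ m → All (Priced m) bs → AllPairs Doubling bs → total bs ≤ 2ℚ * m
  total-≤2m {m} {bs} 0≤m prs dbls =
    ≤-trans (≤-reflexive (same prs)) (sumWhere-≤2x (λ p → w p ≤? m) prs dbls 0≤m (λ p≤m → p≤m))
    where
    same : ∀ {bs} → All (Priced m) bs → total bs ≡ sumWhere (λ p → w p ≤? m) bs
    same [] = refl
    same {(p , c) ∷ bs} (pr ∷ prs) with w p ≤? m
    ... | yes _ = cong (λ z → c + z) (same prs)
    ... | no p≰m = contradiction (Priced.known pr) p≰m

  -- Payments preserve the invariant

  payBlock-sum : ∀ {Q : Block → Set} {P : Page → Set} (P? : Decidable P) {bs} δ (i : Any Q bs) →
    δ ≤ proj₂ (Any.lookup i) →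
    sumWhere P? (payBlock δ i) + when (P? (proj₁ (Any.lookup i))) δ ≡ sumWhere P? bs
  payBlock-sum P? {(p , c) ∷ bs} δ (here _) δ≤c with c ≤? δ
  -- A block that disappears has paid exactly its credit, because no payment exceeds it.
  ... | yes c≤δ rewrite ≤-antisym c≤δ δ≤c =
    solve 2 (λ a b → a :+ b := b :+ a) refl (sumWhere P? bs) (when (P? p) δ)
  ... | no _ with P? p
  ... | yes _ = solve 3 (λ c δ s → (c :- δ) :+ s :+ δ := c :+ s) refl c δ (sumWhere P? bs)
  ... | no _ = +-identityʳ _
  payBlock-sum P? {(p , c) ∷ bs} δ (there i) δ≤c =
    trans (solve 3 (λ a b d → a :+ b :+ d := a :+ (b :+ d)) refl (when (P? p) c) (sumWhere P? (payBlock δ i)) _)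
      (cong (λ z → when (P? p) c + z) (payBlock-sum P? δ i δ≤c))

  priced-pay : ∀ {m p c δ} → 0ℚ ≤ δ → δ ≤ c → Priced m (p , c) → Priced m (p , c - δ)
  priced-pay {c = c} {δ} 0≤δ δ≤c (priced _ c≤w w≤m) = priced (a≤b⇒0≤b-a δ≤c)
    (≤-trans (≤-by-gap 0≤δ (solve 2 (λ c δ → c :- (c :- δ) := δ) refl c δ)) c≤w) w≤m

  -- Stated for properties of the page alone, as a payment changes the credit of a block.
  payBlock-All : ∀ {Q : Block → Set} {P : Page → Set} {bs} δ (i : Any Q bs) →
    All (P ∘ proj₁) bs → All (P ∘ proj₁) (payBlock δ i)
  payBlock-All {bs = (p , c) ∷ bs} δ (here _) (x ∷ xs) with c ≤? δ
  ... | yes _ = xs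
  ... | no _ = x ∷ xs
  payBlock-All δ (there i) (x ∷ xs) = x ∷ payBlock-All δ i xs

  payBlock-priced : ∀ {Q : Block → Set} {m bs} δ (i : Any Q bs) → 0ℚ ≤ δ → δ ≤ proj₂ (Any.lookup i) →
    All (Priced m) bs → All (Priced m) (payBlock δ i)
  payBlock-priced {bs = (p , c) ∷ bs} δ (here _) 0≤δ δ≤c (x ∷ xs) with c ≤? δ
  ... | yes _ = xs
  ... | no _ = priced-pay 0≤δ δ≤c x ∷ xs
  payBlock-priced δ (there i) 0≤δ δ≤c (x ∷ xs) = x ∷ payBlock-priced δ i 0≤δ δ≤c xs

  payBlock-doubling : ∀ {Q : Block → Set} {bs} δ (i : Any Q bs) →
    AllPairs Doubling bs → AllPairs Doubling (payBlock δ i)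
  payBlock-doubling {bs = (p , c) ∷ bs} δ (here _) (x ∷ xs) with c ≤? δ
  ... | yes _ = xs
  ... | no _ = x ∷ xs
  payBlock-doubling δ (there i) (x ∷ xs) = payBlock-All δ i x ∷ payBlock-doubling δ i xs

  pay-ok : ∀ {q m sl} δ (o : Obstacle q sl) → 0ℚ ≤ δ → δ ≤ credit o → SlotOK m sl → SlotOK m (pay δ o)
  pay-ok δ (byGen {c = c} _) 0≤δ δ≤c (slotOK (pr , h) prs dbls) with c ≤? δ
  ... | yes _ = slotOK tt prs dbls
  ... | no _ = slotOK (priced-pay 0≤δ δ≤c pr , h) prs dbls
  pay-ok δ (bySpec {c = c} _) 0≤δ δ≤c (slotOK pr prs dbls) with c ≤? δ
  ... | yes _ = slotOK tt prs dbls
  ... | no _ = slotOK (priced-pay 0≤δ δ≤c pr) prs dbls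
  pay-ok δ (byBlock {ct} i) 0≤δ δ≤c (slotOK cOK prs dbls) =
    slotOK (keep ct cOK) (payBlock-priced δ i 0≤δ δ≤c prs) (payBlock-doubling δ i dbls)
    where
    keep : ∀ {m} ct → ContentOK m (ct ▹ _) → ContentOK m (ct ▹ payBlock δ i)
    keep empty _ = tt
    keep (gen p c) (pr , h) = pr , payBlock-All δ i h
    keep (spec p c) pr = pr

  pay-gen : ∀ {q sl p c} δ (o : Obstacle q sl) → content (pay δ o) ≡ gen p c → ∃ λ c′ → content sl ≡ gen p c′
  pay-gen δ (byGen {c = c} _) eq with c ≤? δ
  pay-gen δ (byGen {c = c} _) () | yes _
  pay-gen δ (byGen {c = c} _) refl | no _ = c , refl
  pay-gen δ (bySpec {c = c} _) eq with c ≤? δ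
  pay-gen δ (bySpec {c = c} _) () | yes _
  pay-gen δ (bySpec {c = c} _) () | no _
  pay-gen δ (byBlock i) eq = _ , eq

  pay-inv : ∀ {q m s} δ (o : ∀ j → Obstacle q (s j)) → 0ℚ ≤ δ → (∀ j → δ ≤ credit (o j)) →
    Inv m s → Inv m (λ j → pay δ (o j))
  pay-inv δ o 0≤δ δ≤ (inv ok uniq) = inv (λ j → pay-ok δ (o j) 0≤δ (δ≤ j) (ok j)) uniq′
    where
    uniq′ : Unique (λ j → pay δ (o j))
    uniq′ {i} {j} isGen isHeld with pay-gen δ (o i) isGen | held-pay δ (o j)
    ... | c′ , isGen′ | inj₂ same = uniq isGen′ (trans (sym same) isHeld)
    ... | c′ , isGen′ | inj₁ gone with trans (sym gone) isHeld
    ... | ()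

  -- Credit of specific pages counts f = 10 times in T: retrieving p for a specific
  -- request has to make up for the loss of a general page of weight up to 8 w(p)
  -- and of the general copy of p.
  contentValue : ℚ → Content → ℚ
  contentValue f empty      = 0ℚ
  contentValue f (gen p c)  = c
  contentValue f (spec p c) = f * c

  value : Slot → ℚ
  value (ct ▹ bs) = contentValue 10ℚ ct + total bs

  -- Credit not covered by the solution

  contentUncovered : Config → Fin k → Content → ℚ
  contentUncovered O j empty      = 0ℚ
  contentUncovered O j (gen p c)  = unless (satisfies? O (p , nothing)) c
  contentUncovered O j (spec p c) = unless (satisfies? O (p , just j)) c

  -- An empty slot of the solution counts as weight 0 and so covers every block of positive weight.
  blocksUncovered : Maybe Page → List Block → ℚ
  blocksUncovered x = sumWhere (λ p → w p ≤? 8ℚ * wᴹ x)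

  uncovered : Config → Fin k → Slot → ℚ
  uncovered O j (ct ▹ bs) = contentUncovered O j ct + blocksUncovered (O j) bs

  pay-value : ∀ {q sl} δ (o : Obstacle q sl) → 0ℚ ≤ δ → δ ≤ credit o → value sl ≤ value (pay δ o) + 10ℚ * δ
  pay-value δ (byGen {c = c} {bs} _) 0≤δ δ≤c with c ≤? δ
  ... | yes c≤δ rewrite ≤-antisym c≤δ δ≤c = ≤-by-gap (0≤* {ℕtoℚ 9} {δ} (0≤ℕtoℚ 9) 0≤δ)
    (solve 2 (λ δ t → con 0ℚ :+ t :+ con 10ℚ :* δ :- (δ :+ t) := con (ℕtoℚ 9) :* δ) refl δ (total bs))
  ... | no _ = ≤-by-gap (0≤* {ℕtoℚ 9} {δ} (0≤ℕtoℚ 9) 0≤δ)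
    (solve 3 (λ δ t c → (c :- δ) :+ t :+ con 10ℚ :* δ :- (c :+ t) := con (ℕtoℚ 9) :* δ) refl δ (total bs) c)
  pay-value δ (bySpec {c = c} {bs} _) 0≤δ δ≤c with c ≤? δ
  ... | yes c≤δ rewrite ≤-antisym c≤δ δ≤c = ≤-reflexive
    (solve 2 (λ δ t → con 10ℚ :* δ :+ t := con 0ℚ :+ t :+ con 10ℚ :* δ) refl δ (total bs))
  ... | no _ = ≤-reflexive
    (solve 3 (λ δ t c → con 10ℚ :* c :+ t := con 10ℚ :* (c :- δ) :+ t :+ con 10ℚ :* δ) refl δ (total bs) c)
  pay-value δ (byBlock {ct} {bs} i) 0≤δ δ≤c
    rewrite sym (payBlock-sum {P = const ⊤} (λ _ → yes tt) δ i δ≤c) =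
    ≤-by-gap (0≤* {ℕtoℚ 9} {δ} (0≤ℕtoℚ 9) 0≤δ)
    (solve 3 (λ δ t c → c :+ t :+ con 10ℚ :* δ :- (c :+ (t :+ δ)) := con (ℕtoℚ 9) :* δ) refl
      δ (total (payBlock δ i)) (contentValue 10ℚ ct))

  Covered : ∀ {q sl} → Config → Fin k → Obstacle q sl → Set
  Covered O j (byGen {p} _)  = Satisfies O (p , nothing)
  Covered O j (bySpec {p} _) = Satisfies O (p , just j)
  Covered O j (byBlock i)    = ¬ (w (proj₁ (Any.lookup i)) ≤ 8ℚ * wᴹ (O j))

  covered? : ∀ {q sl} O j (o : Obstacle q sl) → Dec (Covered O j o)
  covered? O j (byGen {p} _)  = satisfies? O (p , nothing)
  covered? O j (bySpec {p} _) = satisfies? O (p , just j)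
  covered? O j (byBlock i)    = ¬? (w (proj₁ (Any.lookup i)) ≤? 8ℚ * wᴹ (O j))

  -- A covered payer contributes nothing to the uncovered credit, before or after; any other takes
  -- the whole of `δ` out of it.
  pay-uncovered : ∀ {q sl} O j δ (o : Obstacle q sl) → δ ≤ credit o →
    uncovered O j (pay δ o) + unless (covered? O j o) δ ≡ uncovered O j sl
  pay-uncovered O j δ (byGen {p} {c} {bs} _) δ≤c with c ≤? δ
  ... | yes c≤δ rewrite ≤-antisym c≤δ δ≤c =
    solve 2 (λ a b → con 0ℚ :+ a :+ b := b :+ a) refl (blocksUncovered (O j) bs) (unless (satisfies? O (p , nothing)) δ)
  ... | no _ = unless-pay (satisfies? O (p , nothing)) c δ _
  pay-uncovered O j δ (bySpec {p} {c} {bs} _) δ≤c with c ≤? δ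
  ... | yes c≤δ rewrite ≤-antisym c≤δ δ≤c =
    solve 2 (λ a b → con 0ℚ :+ a :+ b := b :+ a) refl (blocksUncovered (O j) bs) (unless (satisfies? O (p , just j)) δ)
  ... | no _ = unless-pay (satisfies? O (p , just j)) c δ _
  pay-uncovered O j δ (byBlock {ct} i) δ≤c
    rewrite unless-¬? (w (proj₁ (Any.lookup i)) ≤? 8ℚ * wᴹ (O j)) δ =
    trans (solve 3 (λ a b d → a :+ b :+ d := a :+ (b :+ d)) refl (contentUncovered O j ct) (blocksUncovered (O j) (payBlock δ i)) _)
      (cong (λ z → contentUncovered O j ct + z) (payBlock-sum (λ p → w p ≤? 8ℚ * wᴹ (O j)) δ i δ≤c))

  -- Counting covered obstacles

  host : ∀ {q sl O j} (o : Obstacle q sl) → Covered O j o → Fin k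
  host (byGen _) (i , _) = i
  host {j = j} (bySpec _)  _ = j
  host {j = j} (byBlock _) _ = j

  -- A clashing block weighs less than twice `w q`, and `w q` is at most four times `w p`: the
  -- factor 8 of the covering rule is the product of 2 and 4.
  clash-uncovered : ∀ {q b p} → Clash q b → ¼ * w q ≤ w p → w b ≤ 8ℚ * w p
  clash-uncovered {q} {b} {p} (_ , ¬heavy) ¼q≤p = ≤-by-gap
    (0≤+ (0≤* {8ℚ} (0≤ℕtoℚ 8) (a≤b⇒0≤b-a ¼q≤p)) (a≤b⇒0≤b-a (<⇒≤ (≰⇒> ¬heavy))))
    (solve 3 (λ q b p → con 8ℚ :* p :- b := con 8ℚ :* (p :- con ¼ :* q) :+ (con 2ℚ :* q :- b)) refl
      (w q) (w b) (w p))

  -- Specific pages and blocks are hosted by their own slots, which are distinct. A general page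
  -- shares its host with no other page by uniqueness, and with no block because a page that is not
  -- light cannot cover a clashing block.
  host-injective : ∀ {q sl sl′ O j j′} (o : Obstacle q sl) (o′ : Obstacle q sl′)
    (cov : Covered O j o) (cov′ : Covered O j′ o′) →
    (∀ {p c} → content sl ≡ gen p c → held (content sl′) ≡ just p → j ≡ j′) →
    (∀ {p c} → content sl′ ≡ gen p c → held (content sl) ≡ just p → j′ ≡ j) →
    host {O = O} o cov ≡ host {O = O} o′ cov′ → j ≡ j′
  host-injective (byGen _) (byGen _) (i , Oi≡p) (i , Oi≡p′) uniq _ refl =
    uniq refl (trans (sym Oi≡p′) Oi≡p)
  host-injective (byGen _) (bySpec _) (i , Oi≡p) Oi≡p′ uniq _ refl =
    uniq refl (trans (sym Oi≡p′) Oi≡p)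
  host-injective {O = O} (byGen ¬light) (byBlock b) (i , Oi≡p) ¬out _ _ refl = contradiction
    (subst (λ x → w (proj₁ (Any.lookup b)) ≤ 8ℚ * wᴹ x) (sym Oi≡p)
      (clash-uncovered (lookup-result b) (<⇒≤ (≰⇒> ¬light)))) ¬out
  host-injective (bySpec _) (byGen _) Oi≡p (i , Oi≡p′) _ uniq refl =
    sym (uniq refl (trans (sym Oi≡p) Oi≡p′))
  host-injective (bySpec _) (bySpec _) _ _ _ _ same = same
  host-injective (bySpec _) (byBlock _) _ _ _ _ same = same
  host-injective (byBlock b) (byGen ¬light) ¬out (i , Oi≡p) _ _ refl = contradiction
    (subst (λ x → w (proj₁ (Any.lookup b)) ≤ 8ℚ * wᴹ x) (sym Oi≡p)
      (clash-uncovered (lookup-result b) (<⇒≤ (≰⇒> ¬light)))) ¬out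
  host-injective (byBlock _) (bySpec _) _ _ _ _ same = same
  host-injective (byBlock _) (byBlock _) _ _ _ _ same = same

  -- A page obstacle covered from slot `i` would be `q` itself, which is not held; and a slot of the
  -- solution with `q` in it covers no block that clashes with `q`.
  host-not-requested : ∀ {q sl O j i} (o : Obstacle q sl) (cov : Covered O j o) →
    O i ≡ just q → held (content sl) ≢ just q → i ≢ host {O = O} o cov
  host-not-requested (byGen _) (i , Oi≡p) Oi≡q unheld refl = unheld (trans (sym Oi≡p) Oi≡q)
  host-not-requested (bySpec _) Oi≡p Oi≡q unheld refl = unheld (trans (sym Oi≡p) Oi≡q)
  host-not-requested {q} (byBlock b) ¬out Oi≡q unheld refl = ¬out
    (subst (λ x → w (proj₁ (Any.lookup b)) ≤ 8ℚ * wᴹ x) (sym Oi≡q)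
      (clash-uncovered (lookup-result b) (¼*≤ (0≤w q))))

  -- Every slot of O covers at most one obstacle, and the slot serving the
  -- request covers none.
  some-uncovered : ∀ {q s O} (o : ∀ j → Obstacle q (s j)) → Unique s →
    ¬ Satisfies (config s) (q , nothing) → Satisfies O (q , nothing) → ∃ λ j → ¬ Covered O j (o j)
  some-uncovered {q} {s} {O} o uniq unsat (i₀ , Oi₀≡q) =
    Fin.¬∀⟶∃¬ k (λ j → Covered O j (o j)) (λ j → covered? O j (o j)) not-all
    where
    not-all : ¬ (∀ j → Covered O j (o j))
    not-all cov with Fin.pigeonhole (ℕ.n<1+n k)
      (λ { zero → i₀ ; (suc j) → host {O = O} (o j) (cov j) })
    ... | zero , suc j , _ , same =
      host-not-requested (o j) (cov j) Oi₀≡q (λ eq → unsat (j , eq)) same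
    ... | suc i , suc j , i<j , same =
      Fin.<⇒≢ i<j (cong suc (host-injective (o i) (o j) (cov i) (cov j) uniq uniq same))

  -- The potential and its behaviour under joint payments

  T : State → ℚ
  T s = sumFin k (value ∘ s)

  Ψ : State → Config → ℚ
  Ψ s O = sumFin k (λ j → uncovered O j (s j))

  K : ℚ
  K = 10ℚ * ℕtoℚ k

  V : State → Config → ℚ
  V s O = T s - K * Ψ s O

  0≤K : 0ℚ ≤ K
  0≤K = 0≤* {10ℚ} {ℕtoℚ k} 0≤10ℚ (0≤ℕtoℚ k)

  -- Expelling a specific page of credit `e` costs `T` ten times `e`, which is repaid when `Ψ` drops
  -- by `e`.
  10*≤K* : ∀ {e} → 0ℚ ≤ e → 10ℚ * e ≤ K * e
  10*≤K* {e} 0≤e = ≤-by-gap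
    (0≤* {10ℚ} 0≤10ℚ (0≤* (a≤b⇒0≤b-a {1ℚ} {ℕtoℚ k} (1≤ℕtoℚ 1≤k)) 0≤e))
    (solve 2 (λ n e → con 10ℚ :* n :* e :- con 10ℚ :* e := con 10ℚ :* ((n :- con 1ℚ) :* e)) refl (ℕtoℚ k) e)

  V-gain : ∀ {s s′ O d x e} → T s + d ≤ T s′ + x → Ψ s′ O + e ≤ Ψ s O → x ≤ K * e →
    V s O + d ≤ V s′ O
  V-gain {s} {s′} {O} {d} {x} {e} T-gain Ψ-loss x≤Ke = ≤-by-gap
    (0≤+ (0≤+ (a≤b⇒0≤b-a T-gain) (0≤* 0≤K (a≤b⇒0≤b-a Ψ-loss))) (a≤b⇒0≤b-a x≤Ke))
    (solve 8 (λ t t′ p p′ n d x e → t′ :- n :* p′ :- (t :- n :* p :+ d) :=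
        (t′ :+ x :- (t :+ d)) :+ n :* (p :- (p′ :+ e)) :+ (n :* e :- x)) refl
      (T s) (T s′) (Ψ s O) (Ψ s′ O) K d x e)

  -- The `k` payments lower `T` by at most `K * δ` in all, and one uncovered payer suffices to lower
  -- `Ψ` by `δ`.
  charge-gain : ∀ {q m s O} (o : ∀ j → Obstacle q (s j)) δ → 0ℚ ≤ δ → (∀ j → δ ≤ credit (o j)) →
    Inv m s → ¬ Satisfies (config s) (q , nothing) → Satisfies O (q , nothing) →
    V s O ≤ V (λ j → pay δ (o j)) O
  charge-gain {s = s} {O} o δ 0≤δ δ≤ I unsat sat with some-uncovered o (unique I) unsat sat
  ... | j₀ , uncov = subst (_≤ V (λ j → pay δ (o j)) O) (+-identityʳ (V s O))
    (V-gain {s} {λ j → pay δ (o j)} {O} T-loss Ψ-loss ≤-refl)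
    where
    T-loss : T s + 0ℚ ≤ T (λ j → pay δ (o j)) + K * δ
    T-loss = subst₂ _≤_ (sym (+-identityʳ (T s)))
      (trans (sum-+ (λ j → value (pay δ (o j))) (λ _ → 10ℚ * δ))
        (cong (λ z → T (λ j → pay δ (o j)) + z) (trans (sum-const k (10ℚ * δ))
          (solve 2 (λ n δ → n :* (con 10ℚ :* δ) := con 10ℚ :* n :* δ) refl (ℕtoℚ k) δ))))
      (sum-mono (λ j → pay-value δ (o j) 0≤δ (δ≤ j)))
    at : unless (covered? O j₀ (o j₀)) δ ≡ δ
    at with covered? O j₀ (o j₀)
    ... | yes cov = contradiction cov uncov
    ... | no _ = refl
    Ψ-loss : Ψ (λ j → pay δ (o j)) O + δ ≤ Ψ s O
    Ψ-loss = sum-gain j₀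
      (λ j _ → ≤-trans (x≤x+y (unless-nonneg (covered? O j (o j)) 0≤δ))
        (≤-reflexive (pay-uncovered O j δ (o j) (δ≤ j))))
      (≤-reflexive (subst (λ z → uncovered O j₀ (pay δ (o j₀)) + z ≡ uncovered O j₀ (s j₀)) at
        (pay-uncovered O j₀ δ (o j₀) (δ≤ j₀))))

  credit-nonneg : ∀ {q m sl} (o : Obstacle q sl) → SlotOK m sl → 0ℚ ≤ credit o
  credit-nonneg (byGen _) (slotOK (pr , _) _ _) = Priced.nonneg pr
  credit-nonneg (bySpec _) (slotOK pr _ _) = Priced.nonneg pr
  credit-nonneg (byBlock i) (slotOK _ prs _) = Priced.nonneg (All.lookupAny prs i .proj₁)

  -- Inserting a general page

  filter-sum : ∀ {P H : Page → Set} (P? : Decidable P) (H? : Decidable H) {m bs} → All (Priced m) bs →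
    sumWhere P? (filter (H? ∘ proj₁) bs) ≤ sumWhere P? bs
  filter-sum P? H? [] = ≤-refl
  filter-sum P? H? {bs = (p , c) ∷ bs} (pr ∷ prs) with H? p
  ... | yes _ = +-monoʳ-≤ (when (P? p) c) (filter-sum P? H? prs)
  ... | no _ = ≤-trans (filter-sum P? H? prs) (x≤y+x (when-nonneg (P? p) (Priced.nonneg pr)))

  -- `L` and `H` stand for light and heavy. A discarded block is not heavy, hence light as nothing
  -- clashes, so the light blocks account for the whole loss.
  filter-total : ∀ {L H : Page → Set} (L? : Decidable L) (H? : Decidable H) {m bs} → All (Priced m) bs →
    All (λ b → ¬ (¬ L (proj₁ b) × ¬ H (proj₁ b))) bs →
    total bs ≤ total (filter (H? ∘ proj₁) bs) + sumWhere L? bs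
  filter-total L? H? [] [] = ≤-refl
  filter-total L? H? {bs = (p , c) ∷ bs} (pr ∷ prs) (L∨H ∷ L∨Hs) with H? p | L? p
  ... | no ¬h | no ¬l = contradiction (¬l , ¬h) L∨H
  ... | yes _ | d = ≤-by-gap
    (0≤+ (a≤b⇒0≤b-a (filter-total L? H? prs L∨Hs)) (when-nonneg d (Priced.nonneg pr)))
    (solve 5 (λ c t f v l → c :+ f :+ (v :+ l) :- (c :+ t) := (f :+ l :- t) :+ v) refl
      c (total bs) (total (filter (H? ∘ proj₁) bs)) (when d c) (sumWhere L? bs))
  ... | no _ | yes _ = ≤-by-gap (a≤b⇒0≤b-a (filter-total L? H? prs L∨Hs))
    (solve 4 (λ c t f l → f :+ (c :+ l) :- (c :+ t) := f :+ l :- t) refl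
      c (total bs) (total (filter (H? ∘ proj₁) bs)) (sumWhere L? bs))

  0≤¼w : ∀ q → 0ℚ ≤ ¼ * w q
  0≤¼w q = 0≤* {¼} 0≤¼ (0≤w q)

  displaceable-value : ∀ {q m ct bs} → Displaceable q ct → ContentOK m (ct ▹ bs) → contentValue 10ℚ ct ≤ ¼ * w q
  displaceable-value {q} {ct = empty} _ _ = 0≤¼w q
  displaceable-value {ct = gen p c} light (pr , _) = ≤-trans (Priced.bounded pr) light
  displaceable-value {ct = spec p c} light pr = ≤-trans
    (≤-by-gap (0≤* {10ℚ} 0≤10ℚ (a≤b⇒0≤b-a (Priced.bounded pr)))
      (solve 2 (λ a c → con 10ℚ :* a :- con 10ℚ :* c := con 10ℚ :* (a :- c)) refl (w p) c)) light

  -- Of the new credit `w q`, one quarter pays for the displaced content and two quarters for the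
  -- discarded light blocks; the last quarter is the gain.
  occupy-value : ∀ {q m} sl → Free q sl → SlotOK m sl → value sl + ¼ * w q ≤ value (occupy q sl)
  occupy-value {q} (ct ▹ bs) (disp , ¬clash) (slotOK cOK prs dbls) = ≤-by-gap
    (0≤+ (0≤+ (a≤b⇒0≤b-a (displaceable-value {ct = ct} disp cOK)) (a≤b⇒0≤b-a (filter-total (light? q) (heavy? q) prs ¬clash)))
      (a≤b⇒0≤b-a (sumWhere-≤2x (light? q) prs dbls (0≤¼w q) (λ light → light))))
    (solve 5 (λ q v t f l → q :+ f :- (v :+ t :+ con ¼ :* q) :=
        (con ¼ :* q :- v) :+ (f :+ l :- t) :+ (con 2ℚ :* (con ¼ :* q) :- l)) refl
      (w q) (contentValue 10ℚ ct) (total bs) (total (filter (heavy? q ∘ proj₁) bs)) (sumWhere (light? q) bs))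

  contentUncovered-nonneg : ∀ {m bs} O j ct → ContentOK m (ct ▹ bs) → 0ℚ ≤ contentUncovered O j ct
  contentUncovered-nonneg O j empty _ = ≤-refl
  contentUncovered-nonneg O j (gen p c) (pr , _) = unless-nonneg (satisfies? O (p , nothing)) (Priced.nonneg pr)
  contentUncovered-nonneg O j (spec p c) pr = unless-nonneg (satisfies? O (p , just j)) (Priced.nonneg pr)

  uncovered-nonneg : ∀ {m} O j sl → SlotOK m sl → 0ℚ ≤ uncovered O j sl
  uncovered-nonneg O j (ct ▹ bs) (slotOK cOK prs _) =
    0≤+ (contentUncovered-nonneg O j ct cOK) (sumWhere-nonneg (λ p → w p ≤? 8ℚ * wᴹ (O j)) prs)

  -- The solution serves the request, so the new credit is covered and old terms can only disappear.
  occupy-uncovered : ∀ {q m} O j sl → Satisfies O (q , nothing) → SlotOK m sl →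
    uncovered O j (occupy q sl) ≤ uncovered O j sl
  occupy-uncovered {q} O j (ct ▹ bs) sat (slotOK cOK prs _) with satisfies? O (q , nothing)
  ... | yes _ = +-mono-≤ (contentUncovered-nonneg O j ct cOK) (filter-sum (λ p → w p ≤? 8ℚ * wᴹ (O j)) (heavy? q) prs)
  ... | no unsat = contradiction sat unsat

  occupy-ok : ∀ {q m} sl → w q ≤ m → SlotOK m sl → SlotOK m (occupy q sl)
  occupy-ok {q} (ct ▹ bs) q≤m (slotOK _ prs dbls) = slotOK
    (priced (0≤w q) ≤-refl q≤m , all-filter (heavy? q ∘ proj₁) bs)
    (All-filter⁺ (heavy? q ∘ proj₁) prs) (AllPairs-filter⁺ (heavy? q ∘ proj₁) dbls)

  insert-inv : ∀ {q m s} j → ¬ Satisfies (config s) (q , nothing) → w q ≤ m → Inv m s →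
    Inv m (updateAt s j (occupy q))
  insert-inv {q} {m} {s} j unsat q≤m (inv ok uniq) = inv ok′ uniq′
    where
    s′ : State
    s′ = updateAt s j (occupy q)
    ok′ : ∀ i → SlotOK m (s′ i)
    ok′ i with i Fin.≟ j
    ... | yes refl = subst (SlotOK m) (sym (updateAt-updates j s)) (occupy-ok (s j) q≤m (ok j))
    ... | no i≢j = subst (SlotOK m) (sym (updateAt-minimal i j s i≢j)) (ok i)
    uniq′ : Unique s′
    uniq′ {a} {b} isGen isHeld with a Fin.≟ j | b Fin.≟ j
    ... | yes refl | yes refl = refl
    ... | no a≢j | no b≢j = uniq (trans (cong content (sym (updateAt-minimal a j s a≢j))) isGen)
      (trans (cong (held ∘ content) (sym (updateAt-minimal b j s b≢j))) isHeld)
    -- In the two mixed cases another slot would have held `q` before the insertion.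
    ... | yes refl | no b≢j = contradiction
      (b , trans (cong (held ∘ content) (sym (updateAt-minimal b j s b≢j)))
        (trans isHeld (trans (cong held (sym isGen)) (cong (held ∘ content) (updateAt-updates j s))))) unsat
    ... | no a≢j | yes refl = contradiction
      (a , trans (cong (held ∘ content) (sym (updateAt-minimal a j s a≢j)))
        (trans (cong held isGen) (trans (sym isHeld) (cong (held ∘ content) (updateAt-updates j s))))) unsat

  pay-unsat : ∀ {q r s} δ (o : ∀ j → Obstacle q (s j)) → ¬ Satisfies (config s) (r , nothing) →
    ¬ Satisfies (config (λ j → pay δ (o j))) (r , nothing)
  pay-unsat δ o unsat (j , isHeld) with held-pay δ (o j)
  ... | inj₂ same = unsat (j , trans (sym same) isHeld)
  ... | inj₁ gone with trans (sym gone) isHeld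
  ... | ()

  place-gain : ∀ {q m s s′ O} → Place q s s′ → Inv m s → ¬ Satisfies (config s) (q , nothing) →
    Satisfies O (q , nothing) → w q ≤ m → Inv m s′ × V s O + ¼ * w q ≤ V s′ O
  place-gain {q} {m} {O = O} (insert {s} j free) I unsat sat q≤m = insert-inv j unsat q≤m I ,
    V-gain {s} {s′} {O}
      (subst (T s + ¼ * w q ≤_) (sym (+-identityʳ (T s′)))
        (sum-gain j (λ i i≢j → ≤-reflexive (cong value (sym (updateAt-minimal i j s i≢j))))
          (subst (λ sl → value (s j) + ¼ * w q ≤ value sl) (sym (updateAt-updates j s))
            (occupy-value (s j) free (slots I j)))))
      (sum-gain {d = 0ℚ} j (λ i i≢j → ≤-reflexive (cong (uncovered O i) (updateAt-minimal i j s i≢j)))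
        (subst (λ sl → uncovered O j sl + 0ℚ ≤ uncovered O j (s j)) (sym (updateAt-updates j s))
          (subst (_≤ uncovered O j (s j)) (sym (+-identityʳ (uncovered O j (occupy q (s j)))))
            (occupy-uncovered O j (s j) sat (slots I j)))))
      (≤-reflexive (sym (*-zeroʳ K)))
    where
    s′ : State
    s′ = updateAt s j (occupy q)
  place-gain {q} {m} {O = O} (charge {s} o j min pl) I unsat sat q≤m
    with place-gain {O = O} pl (pay-inv δ o 0≤δ min I) (pay-unsat δ o unsat) sat q≤m
    where
    δ : ℚ
    δ = credit (o j)
    0≤δ : 0ℚ ≤ δ
    0≤δ = credit-nonneg (o j) (slots I j)
  ... | I′ , gain = I′ , ≤-trans
    (+-monoˡ-≤ (¼ * w q) (charge-gain {O = O} o (credit (o j)) (credit-nonneg (o j) (slots I j)) min I unsat sat)) gain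

  -- Forcing a specific page into its slot

  genCredit : Maybe Page → Content → ℚ
  genCredit x (gen p c) = when (x ≟ᴹ just p) c
  genCredit x _         = 0ℚ

  genCredit-nonneg : ∀ {m bs} x ct → ContentOK m (ct ▹ bs) → 0ℚ ≤ genCredit x ct
  genCredit-nonneg x empty _ = ≤-refl
  genCredit-nonneg x (gen p c) (pr , _) = when-nonneg (x ≟ᴹ just p) (Priced.nonneg pr)
  genCredit-nonneg x (spec p c) _ = ≤-refl

  genCredit-bounded : ∀ {m bs} x ct → ContentOK m (ct ▹ bs) → genCredit x ct ≤ wᴹ x
  genCredit-bounded x empty _ = 0≤wᴹ x
  genCredit-bounded x (gen p c) (pr , _) with x ≟ᴹ just p
  ... | yes refl = Priced.bounded pr
  ... | no _ = 0≤wᴹ x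
  genCredit-bounded x (spec p c) _ = 0≤wᴹ x

  HoldsGen : Maybe Page → Content → Set
  HoldsGen x ct = ∃ λ p → ∃ λ c → ct ≡ gen p c × x ≡ just p

  holdsGen⊎0 : ∀ x ct → HoldsGen x ct ⊎ genCredit x ct ≡ 0ℚ
  holdsGen⊎0 x empty = inj₂ refl
  holdsGen⊎0 x (gen p c) with x ≟ᴹ just p
  ... | yes x≡p = inj₁ (p , c , refl , x≡p)
  ... | no _ = inj₂ refl
  holdsGen⊎0 x (spec p c) = inj₂ refl

  -- By uniqueness at most one slot contributes. The bound serves twice: for the general copy
  -- removed by `force`, and for the general page uncovered when the solution drops `x`.
  genCredit-sum : ∀ {m s} x → Inv m s → sumFin k (λ j → genCredit x (content (s j))) ≤ wᴹ x
  genCredit-sum {s = s} x I with search (λ j → holdsGen⊎0 x (content (s j)))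
  ... | inj₂ none = ≤-trans (sum-mono (λ j → ≤-reflexive (none j)))
    (≤-trans (≤-reflexive (sum-0 k)) (0≤wᴹ x))
  ... | inj₁ (j , p , c , isGen , refl) = sum-single j others
    (genCredit-bounded (just p) (content (s j)) (contentOK (slots I j)))
    where
    others : ∀ i → i ≢ j → genCredit (just p) (content (s i)) ≤ 0ℚ
    others i i≢j with holdsGen⊎0 (just p) (content (s i))
    ... | inj₂ zero-credit = ≤-reflexive zero-credit
    ... | inj₁ (_ , _ , isGen′ , refl) = contradiction (unique I isGen′ (cong held isGen)) i≢j

  evictGen-value : ∀ p sl → value sl ≤ value (evictGen p sl) + genCredit (just p) (content sl)
  evictGen-value p (empty ▹ bs) = ≤-reflexive (sym (+-identityʳ _))
  evictGen-value p (spec _ _ ▹ bs) = ≤-reflexive (sym (+-identityʳ _))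
  evictGen-value p (gen g c ▹ bs) with g ≟ p | just p ≟ᴹ just g
  ... | yes _ | yes _ = ≤-reflexive (solve 2 (λ c t → c :+ t := con 0ℚ :+ t :+ c) refl c (total bs))
  ... | yes refl | no p≢g = contradiction refl p≢g
  ... | no g≢p | yes refl = contradiction refl g≢p
  ... | no _ | no _ = ≤-reflexive (sym (+-identityʳ _))

  evictGen-uncovered : ∀ {m} O j p sl → SlotOK m sl → uncovered O j (evictGen p sl) ≤ uncovered O j sl
  evictGen-uncovered O j p (empty ▹ bs) _ = ≤-refl
  evictGen-uncovered O j p (spec _ _ ▹ bs) _ = ≤-refl
  evictGen-uncovered O j p (gen g c ▹ bs) (slotOK cOK _ _) with g ≟ p
  ... | yes _ = +-monoˡ-≤ (blocksUncovered (O j) bs) (contentUncovered-nonneg O j (gen g c) cOK)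
  ... | no _ = ≤-refl

  evictGen-gen : ∀ {g c} p sl → content (evictGen p sl) ≡ gen g c → content sl ≡ gen g c × g ≢ p
  evictGen-gen p (gen g c ▹ bs) eq with g ≟ p
  evictGen-gen p (gen g c ▹ bs) refl | no g≢p = refl , g≢p

  evictGen-ok : ∀ {m} p sl → SlotOK m sl → SlotOK m (evictGen p sl)
  evictGen-ok p (empty ▹ bs) ok = ok
  evictGen-ok p (spec _ _ ▹ bs) ok = ok
  evictGen-ok p (gen g c ▹ bs) ok with g ≟ p
  ... | yes _ = slotOK tt (blocksOK ok) (doubling ok)
  ... | no _ = ok

  install-ok : ∀ {m} p sl → w p ≤ m → SlotOK m sl → SlotOK m (install p sl)
  install-ok p (empty ▹ bs) p≤m ok = slotOK (priced (0≤w p) ≤-refl p≤m) (blocksOK ok) (doubling ok)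
  install-ok p (spec _ _ ▹ bs) p≤m ok = slotOK (priced (0≤w p) ≤-refl p≤m) (blocksOK ok) (doubling ok)
  install-ok p (gen g c ▹ bs) p≤m (slotOK (pr , dbl) prs dbls) with w g ≤? 8ℚ * w p
  ... | yes _ = slotOK (priced (0≤w p) ≤-refl p≤m) prs dbls
  ... | no _ = slotOK (priced (0≤w p) ≤-refl p≤m) (pr ∷ prs) (dbl ∷ dbls)

  install-not-gen : ∀ {g c} p sl → content (install p sl) ≢ gen g c
  install-not-gen p (gen g c ▹ bs) eq with w g ≤? 8ℚ * w p
  install-not-gen p (gen g c ▹ bs) () | yes _
  install-not-gen p (gen g c ▹ bs) () | no _

  -- `e` is the uncovered credit that leaves with an expelled specific page. Its tenfold loss in `T`
  -- is kept apart because the drop of `Ψ` pays for it.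
  InstallGain : Config → Fin k → Page → Slot → Set
  InstallGain O j p sl = ∃ λ e → 0ℚ ≤ e ×
    value sl + (2ℚ * w p - 10ℚ * e) ≤ value (install p sl) ×
    uncovered O j (install p sl) + e ≤ uncovered O j sl

  install-gain : ∀ {m} O j p sl → O j ≡ just p → held (content sl) ≢ just p → SlotOK m sl →
    InstallGain O j p sl
  install-gain O j p (empty ▹ bs) Oj≡p unheld ok with O j ≟ᴹ just p
  ... | no Oj≢p = contradiction Oj≡p Oj≢p
  ... | yes _ = 0ℚ , ≤-refl , ≤-by-gap (0≤* {8ℚ} (0≤ℕtoℚ 8) (0≤w p))
      (solve 2 (λ p t → con 10ℚ :* p :+ t :- (con 0ℚ :+ t :+ (con 2ℚ :* p :- con 10ℚ :* con 0ℚ)) := con 8ℚ :* p) refl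
        (w p) (total bs))
    , ≤-reflexive (+-identityʳ _)
  install-gain O j p (spec y c ▹ bs) Oj≡p unheld (slotOK pr _ _) with O j ≟ᴹ just p | O j ≟ᴹ just y
  ... | no Oj≢p | _ = contradiction Oj≡p Oj≢p
  ... | yes _ | yes Oj≡y = contradiction (trans (sym Oj≡y) Oj≡p) unheld
  -- The solution has `p` in slot `j`, so the expelled specific page `y` was uncovered and its
  -- credit can serve as `e`.
  ... | yes _ | no _ = c , Priced.nonneg pr , ≤-by-gap (0≤* {8ℚ} (0≤ℕtoℚ 8) (0≤w p))
      (solve 3 (λ p t c → con 10ℚ :* p :+ t :- (con 10ℚ :* c :+ t :+ (con 2ℚ :* p :- con 10ℚ :* c)) := con 8ℚ :* p) refl
        (w p) (total bs) c)
    , ≤-reflexive (solve 2 (λ b c → con 0ℚ :+ b :+ c := c :+ b) refl (blocksUncovered (O j) bs) c)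
  install-gain O j p (gen g c ▹ bs) Oj≡p unheld (slotOK (pr , dbl) prs dbls) with w g ≤? 8ℚ * w p
  -- The lost credit is at most `8ℚ * w p`, which leaves 2 of the 10 units that `p` brings.
  ... | yes g≤8p = 0ℚ , ≤-refl , ≤-by-gap (a≤b⇒0≤b-a (≤-trans (Priced.bounded pr) g≤8p))
      (solve 3 (λ p t c → con 10ℚ :* p :+ t :- (c :+ t :+ (con 2ℚ :* p :- con 10ℚ :* con 0ℚ)) := con 8ℚ :* p :- c) refl
        (w p) (total bs) c)
    , subst (_≤ uncovered O j (gen g c ▹ bs)) (sym (+-identityʳ _))
        (+-monoˡ-≤ (blocksUncovered (O j) bs)
          (≤-trans (≤-reflexive covered) (contentUncovered-nonneg O j (gen g c) (pr , dbl))))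
    where
    covered : contentUncovered O j (spec p (w p)) ≡ 0ℚ
    covered with O j ≟ᴹ just p
    ... | yes _ = refl
    ... | no Oj≢p = contradiction Oj≡p Oj≢p
  -- The credit of `g` stays in the slot as a block, and `g≰8p` says that the block is covered.
  ... | no g≰8p = 0ℚ , ≤-refl , ≤-by-gap (0≤* {8ℚ} (0≤ℕtoℚ 8) (0≤w p))
      (solve 3 (λ p t c → con 10ℚ :* p :+ (c :+ t) :- (c :+ t :+ (con 2ℚ :* p :- con 10ℚ :* con 0ℚ)) := con 8ℚ :* p) refl
        (w p) (total bs) c)
    , subst (_≤ uncovered O j (gen g c ▹ bs)) (sym (+-identityʳ _))
        (+-mono-≤
          (≤-trans (≤-reflexive covered) (contentUncovered-nonneg O j (gen g c) (pr , dbl)))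
          (≤-reflexive block-covered))
    where
    covered : contentUncovered O j (spec p (w p)) ≡ 0ℚ
    covered with O j ≟ᴹ just p
    ... | yes _ = refl
    ... | no Oj≢p = contradiction Oj≡p Oj≢p
    block-covered : blocksUncovered (O j) ((g , c) ∷ bs) ≡ blocksUncovered (O j) bs
    block-covered with w g ≤? 8ℚ * wᴹ (O j)
    ... | yes g≤ = contradiction (subst (λ x → w g ≤ 8ℚ * wᴹ x) Oj≡p g≤) g≰8p
    ... | no _ = +-identityˡ _

  force-inv : ∀ {m s} p j → w p ≤ m → Inv m s → Inv m (force p j s)
  force-inv {m} {s} p j p≤m (inv ok uniq) = inv ok′ uniq′
    where
    ok′ : ∀ i → SlotOK m (force p j s i)
    ok′ i with i Fin.≟ j
    ... | yes _ = install-ok p (s i) p≤m (ok i)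
    ... | no _ = evictGen-ok p (s i) (ok i)
    uniq′ : Unique (force p j s)
    uniq′ {a} {b} isGen isHeld with a Fin.≟ j | b Fin.≟ j
    ... | yes refl | _ = contradiction isGen (install-not-gen p (s a))
    ... | no _ | yes refl = contradiction
      (just-injective (trans (sym isHeld) (held-install p (s b)))) (proj₂ (evictGen-gen p (s a) isGen))
    ... | no _ | no _ with held-evictGen p (s b)
    ... | inj₂ same = uniq (proj₁ (evictGen-gen p (s a) isGen)) (trans (sym same) isHeld)
    ... | inj₁ gone with trans (sym gone) isHeld
    ... | ()

  -- Of the `2ℚ * w p` gained in slot `j`, at most `w p` is lost with a general copy of `p`
  -- elsewhere.
  force-gain : ∀ {m s O} p j → Inv m s → ¬ Satisfies (config s) (p , just j) →
    Satisfies O (p , just j) → V s O + w p ≤ V (force p j s) O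
  force-gain {s = s} {O} p j I unsat sat with install-gain O j p (s j) sat unsat (slots I j)
  ... | e , 0≤e , v-gain , u-loss = V-gain {s} {s′} {O} T-gain
    (sum-gain j
      (λ i i≢j → subst (λ sl → uncovered O i sl ≤ uncovered O i (s i)) (sym (force-off p s i≢j))
        (evictGen-uncovered O i p (s i) (slots I i)))
      (subst (λ sl → uncovered O j sl + e ≤ uncovered O j (s j)) (sym (force-at p j s)) u-loss))
    (10*≤K* 0≤e)
    where
    s′ : State
    s′ = force p j s
    h : Fin k → ℚ
    h i = genCredit (just p) (content (s i))
    raw : T s + (2ℚ * w p - 10ℚ * e) ≤ sumFin k (λ i → value (s′ i) + h i)
    raw = sum-gain j
      (λ i i≢j → subst (λ sl → value (s i) ≤ value sl + h i) (sym (force-off p s i≢j)) (evictGen-value p (s i)))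
      (subst (λ sl → value (s j) + (2ℚ * w p - 10ℚ * e) ≤ value sl + h j) (sym (force-at p j s))
        (≤-trans v-gain (x≤x+y (genCredit-nonneg (just p) (content (s j)) (contentOK (slots I j))))))
    T-gain : T s + w p ≤ T s′ + 10ℚ * e
    T-gain = ≤-by-gap
      (0≤+ (a≤b⇒0≤b-a (subst (T s + (2ℚ * w p - 10ℚ * e) ≤_) (sum-+ (value ∘ s′) h) raw))
        (a≤b⇒0≤b-a (genCredit-sum (just p) I)))
      (solve 5 (λ t t′ h p e → t′ :+ con 10ℚ :* e :- (t :+ p) :=
          (t′ :+ h :- (t :+ (con 2ℚ :* p :- con 10ℚ :* e))) :+ (p :- h)) refl
        (T s) (T s′) (sumFin k h) (w p) e)

  -- Retrieval costs

  slotCost-same : ∀ x → slotCost x x ≡ 0ℚ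
  slotCost-same nothing = refl
  slotCost-same (just p) with p ≟ p
  ... | yes _ = refl
  ... | no p≢p = contradiction refl p≢p

  slotCost-≢ : ∀ x y → x ≢ y → slotCost x y ≡ wᴹ y
  slotCost-≢ x nothing x≢y = refl
  slotCost-≢ nothing (just p) x≢y = refl
  slotCost-≢ (just q) (just p) x≢y with q ≟ p
  ... | yes refl = contradiction refl x≢y
  ... | no _ = refl

  slotCost-bounded : ∀ x y → slotCost x y ≤ wᴹ y
  slotCost-bounded x y with x ≟ᴹ y
  ... | yes refl = ≤-trans (≤-reflexive (slotCost-same x)) (0≤wᴹ x)
  ... | no x≢y = ≤-reflexive (slotCost-≢ x y x≢y)

  slotCost-nonneg : ∀ x y → 0ℚ ≤ slotCost x y
  slotCost-nonneg x y with x ≟ᴹ y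
  ... | yes refl = ≤-reflexive (sym (slotCost-same x))
  ... | no x≢y = subst (0ℚ ≤_) (sym (slotCost-≢ x y x≢y)) (0≤wᴹ y)

  fetch-cost : ∀ {p j C C′} → Fetches p j C C′ → stepCost C C′ ≤ w p
  fetch-cost {p} {j} {C} {C′} f = sum-single j others
    (≤-trans (slotCost-bounded (C j) (C′ j)) (≤-reflexive (cong wᴹ (Fetches.there-now f))))
    where
    others : ∀ i → i ≢ j → slotCost (C i) (C′ i) ≤ 0ℚ
    others i i≢j with Fetches.elsewhere f i i≢j
    ... | inj₁ gone rewrite gone = ≤-refl
    ... | inj₂ same rewrite same = ≤-reflexive (slotCost-same (C i))

  -- A step retrieves at most the requested page, once. The factor `¼` is dictated by insertions; a
  -- forced request gains the full weight.
  handled-gain : ∀ {m s r s′ O} → Handled s r s′ → Inv m s → Satisfies O r → w (proj₁ r) ≤ m →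
    Inv m s′ × V s O + ¼ * stepCost (config s) (config s′) ≤ V s′ O
  handled-gain {s = s} {O = O} (hit _) I sat p≤m = I , ≤-reflexive
    (trans (cong (λ z → V s O + ¼ * z)
        (trans (sum-cong (λ i → slotCost-same (config s i))) (sum-0 k)))
      (solve 1 (λ v → v :+ con ¼ :* con 0ℚ := v) refl (V s O)))
  handled-gain {s = s} {O = O} (forced {p} {j} unsat) I sat p≤m = force-inv p j p≤m I ,
    ≤-trans (+-monoʳ-≤ (V s O) (≤-trans (¼*-mono (fetch-cost (force-fetches p j s))) (¼*≤ (0≤w p))))
      (force-gain {O = O} p j I unsat sat)
  handled-gain {s = s} {O = O} (placed {p} unsat pl) I sat p≤m with place-gain {O = O} pl I unsat sat p≤m
  ... | I′ , gain = I′ , ≤-trans (+-monoʳ-≤ (V s O) (¼*-mono (fetch-cost (proj₂ (place-fetches pl))))) gain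

  -- Moves of the solution

  W : Config → ℚ
  W O = sumFin k (wᴹ ∘ O)

  module Move (O O′ : Config) where

    ifMoved : Fin k → ℚ → ℚ
    ifMoved i = unless (O i ≟ᴹ O′ i)

    ifMoved-nonneg : ∀ i {c} → 0ℚ ≤ c → 0ℚ ≤ ifMoved i c
    ifMoved-nonneg i = unless-nonneg (O i ≟ᴹ O′ i)

    -- A general page may lose its cover in any slot of the solution, hence the sum over all `i`.
    genLoss : Content → ℚ
    genLoss ct = sumFin k (λ i → ifMoved i (genCredit (O i) ct))

    genLoss-nonneg : ∀ {m bs} ct → ContentOK m (ct ▹ bs) → 0ℚ ≤ genLoss ct
    genLoss-nonneg ct ok = sum-nonneg (λ i → ifMoved-nonneg i (genCredit-nonneg (O i) ct ok))

    ifMoved-≡ : ∀ {i c p} → O i ≡ just p → O′ i ≢ just p → ifMoved i c ≡ c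
    ifMoved-≡ {i} Oi≡p O′i≢p with O i ≟ᴹ O′ i
    ... | yes same = contradiction (trans (sym same) Oi≡p) O′i≢p
    ... | no _ = refl

    content-move : ∀ {m bs} j ct → ContentOK m (ct ▹ bs) →
      contentUncovered O′ j ct ≤ contentUncovered O j ct + (ifMoved j (wᴹ (O j)) + genLoss ct)
    content-move {m} {bs} j empty ok =
      0≤+ {0ℚ} ≤-refl (0≤+ (ifMoved-nonneg j (0≤wᴹ (O j))) (genLoss-nonneg {m} {bs} empty ok))
    content-move {m} {bs} j (spec p c) ok with O′ j ≟ᴹ just p | O j ≟ᴹ just p
    ... | yes _ | d = 0≤+ (unless-nonneg d (Priced.nonneg ok))
      (0≤+ (ifMoved-nonneg j (0≤wᴹ (O j))) (genLoss-nonneg {m} {bs} (spec p c) ok))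
    ... | no _ | no _ = x≤x+y (0≤+ (ifMoved-nonneg j (0≤wᴹ (O j))) (genLoss-nonneg {m} {bs} (spec p c) ok))
    ... | no O′j≢p | yes Oj≡p = ≤-trans (≤-trans (Priced.bounded ok)
        (≤-reflexive (sym (trans (ifMoved-≡ Oj≡p O′j≢p) (cong wᴹ Oj≡p)))))
      (≤-trans (x≤x+y (genLoss-nonneg {m} {bs} (spec p c) ok)) (≤-reflexive (sym (+-identityˡ _))))
    content-move {m} {bs} j (gen p c) ok
      with satisfies? O′ (p , nothing) | satisfies? O (p , nothing)
    ... | yes _ | d = 0≤+ (unless-nonneg d (Priced.nonneg (proj₁ ok)))
      (0≤+ (ifMoved-nonneg j (0≤wᴹ (O j))) (genLoss-nonneg {m} {bs} (gen p c) ok))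
    ... | no _ | no _ = x≤x+y (0≤+ (ifMoved-nonneg j (0≤wᴹ (O j))) (genLoss-nonneg {m} {bs} (gen p c) ok))
    -- Slot `i` of `O` held `p` and no slot of `O′` does, so the term of `genLoss` at `i` is the
    -- whole credit.
    ... | no gone | yes (i , Oi≡p) = ≤-trans (≤-reflexive (sym at))
      (≤-trans (term≤sum (λ i → ifMoved-nonneg i (genCredit-nonneg {m} {bs} (O i) (gen p c) ok)) i)
        (≤-trans (x≤y+x (ifMoved-nonneg j (0≤wᴹ (O j)))) (≤-reflexive (sym (+-identityˡ _)))))
      where
      counted : genCredit (O i) (gen p c) ≡ c
      counted with O i ≟ᴹ just p
      ... | yes _ = refl
      ... | no Oi≢p = contradiction Oi≡p Oi≢p
      at : ifMoved i (genCredit (O i) (gen p c)) ≡ c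
      at = trans (ifMoved-≡ Oi≡p (λ O′i≡p → gone (i , O′i≡p))) counted

    -- A block uncovered by `O′` weighs at most `8ℚ * wᴹ (O′ j)`. By doubling, all of them together
    -- have at most twice that credit, whatever was uncovered before.
    blocks-move : ∀ {m bs} j → All (Priced m) bs → AllPairs Doubling bs →
      blocksUncovered (O′ j) bs ≤ blocksUncovered (O j) bs + ifMoved j (16ℚ * wᴹ (O′ j))
    blocks-move {bs = bs} j prs dbls with O j ≟ᴹ O′ j
    ... | yes same rewrite same = ≤-reflexive (sym (+-identityʳ _))
    ... | no _ = ≤-trans
      (sumWhere-≤2x (λ p → w p ≤? 8ℚ * wᴹ (O′ j)) prs dbls (0≤* {8ℚ} (0≤ℕtoℚ 8) (0≤wᴹ (O′ j))) (λ p≤ → p≤))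
      (≤-trans (≤-reflexive (solve 1 (λ x → con 2ℚ :* (con 8ℚ :* x) := con 16ℚ :* x) refl (wᴹ (O′ j))))
        (x≤y+x (sumWhere-nonneg (λ p → w p ≤? 8ℚ * wᴹ (O j)) prs)))

    paid : Fin k → ℚ
    paid j = ifMoved j (wᴹ (O j)) + ifMoved j (16ℚ * wᴹ (O′ j))

    slot-move : ∀ {m} j sl → SlotOK m sl →
      uncovered O′ j sl ≤ uncovered O j sl + paid j + genLoss (content sl)
    slot-move j (ct ▹ bs) (slotOK cOK prs dbls) = ≤-trans
      (+-mono-≤ (content-move j ct cOK) (blocks-move j prs dbls))
      (≤-reflexive (solve 5 (λ c a g b d → c :+ (a :+ g) :+ (b :+ d) := c :+ b :+ (a :+ d) :+ g) refl
        (contentUncovered O j ct) (ifMoved j (wᴹ (O j))) (genLoss ct)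
        (blocksUncovered (O j) bs) (ifMoved j (16ℚ * wᴹ (O′ j)))))

    -- Swapping the sums groups the loss by the slots of the solution, each of which uncovers at
    -- most the weight of the page it drops.
    genLoss-sum : ∀ {m s} → Inv m s →
      sumFin k (λ j → genLoss (content (s j))) ≤ sumFin k (λ i → ifMoved i (wᴹ (O i)))
    genLoss-sum {s = s} I = ≤-trans
      (≤-reflexive (sum-swap (λ j i → ifMoved i (genCredit (O i) (content (s j))))))
      (sum-mono each)
      where
      each : ∀ i → sumFin k (λ j → ifMoved i (genCredit (O i) (content (s j)))) ≤ ifMoved i (wᴹ (O i))
      each i with O i ≟ᴹ O′ i
      ... | yes _ = ≤-reflexive (sum-0 k)
      ... | no _ = genCredit-sum (O i) I

    -- The solution pays for pages coming in, not for those going out. So `2ℚ * wᴹ` is a deposit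
    -- made on arrival and spent on departure, once for specific and once for general credit; 18 is
    -- 16 for the blocks plus this deposit.
    paid-by-cost : ∀ i → paid i + ifMoved i (wᴹ (O i)) + 2ℚ * wᴹ (O′ i) ≤
      2ℚ * wᴹ (O i) + 18ℚ * slotCost (O i) (O′ i)
    paid-by-cost i with O i ≟ᴹ O′ i
    ... | yes same rewrite same | slotCost-same (O′ i) = ≤-reflexive
      (solve 1 (λ x → con 0ℚ :+ con 2ℚ :* x := con 2ℚ :* x :+ con 18ℚ :* con 0ℚ) refl (wᴹ (O′ i)))
    ... | no moved rewrite slotCost-≢ (O i) (O′ i) moved = ≤-reflexive
      (solve 2 (λ x y → x :+ con 16ℚ :* y :+ x :+ con 2ℚ :* y := con 2ℚ :* x :+ con 18ℚ :* y) refl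
        (wᴹ (O i)) (wᴹ (O′ i)))

    Ψ-move : ∀ {m s} → Inv m s →
      Ψ s O′ + 2ℚ * W O′ ≤ Ψ s O + (2ℚ * W O + 18ℚ * stepCost O O′)
    Ψ-move {s = s} I = ≤-by-gap
      (0≤+ (0≤+ (a≤b⇒0≤b-a Ψ-bound) (a≤b⇒0≤b-a (genLoss-sum I))) (a≤b⇒0≤b-a cost-bound))
      (solve 8 (λ f f′ a g h x x′ c → f :+ (con 2ℚ :* x :+ con 18ℚ :* c) :- (f′ :+ con 2ℚ :* x′) :=
          (f :+ a :+ g :- f′) :+ (h :- g) :+ (con 2ℚ :* x :+ con 18ℚ :* c :- (a :+ h :+ con 2ℚ :* x′))) refl
        (Ψ s O) (Ψ s O′) (sumFin k paid) (sumFin k (λ j → genLoss (content (s j))))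
        (sumFin k (λ i → ifMoved i (wᴹ (O i)))) (W O) (W O′) (stepCost O O′))
      where
      f left : Fin k → ℚ
      f j = uncovered O j (s j)
      left i = ifMoved i (wᴹ (O i))
      Ψ-bound : Ψ s O′ ≤ Ψ s O + sumFin k paid + sumFin k (λ j → genLoss (content (s j)))
      Ψ-bound = ≤-trans (sum-mono (λ j → slot-move j (s j) (slots I j)))
        (≤-reflexive (trans (sum-+ (λ j → f j + paid j) (λ j → genLoss (content (s j))))
          (cong (λ z → z + sumFin k (λ j → genLoss (content (s j)))) (sum-+ f paid))))
      cost-bound : sumFin k paid + sumFin k left + 2ℚ * W O′ ≤ 2ℚ * W O + 18ℚ * stepCost O O′
      cost-bound = subst₂ _≤_
        (trans (sum-+ (λ i → paid i + left i) (λ i → 2ℚ * wᴹ (O′ i)))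
          (cong₂ _+_ (sum-+ paid left) (sum-* 2ℚ (wᴹ ∘ O′))))
        (trans (sum-+ (λ i → 2ℚ * wᴹ (O i)) (λ i → 18ℚ * slotCost (O i) (O′ i)))
          (cong₂ _+_ (sum-* 2ℚ (wᴹ ∘ O)) (sum-* 18ℚ (λ i → slotCost (O i) (O′ i)))))
        (sum-mono paid-by-cost)

  -- Amortisation against the cost of the solution

  W-move : ∀ O O′ → W O′ ≤ W O + stepCost O O′
  W-move O O′ = subst (W O′ ≤_) (sum-+ (wᴹ ∘ O) (λ i → slotCost (O i) (O′ i))) (sum-mono each)
    where
    each : ∀ i → wᴹ (O′ i) ≤ wᴹ (O i) + slotCost (O i) (O′ i)
    each i with O i ≟ᴹ O′ i
    ... | yes same = ≤-trans (≤-reflexive (cong wᴹ (sym same))) (x≤x+y (slotCost-nonneg (O i) (O′ i)))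
    ... | no moved = ≤-trans (≤-reflexive (sym (slotCost-≢ (O i) (O′ i) moved))) (x≤y+x (0≤wᴹ (O i)))

  0≤W : ∀ O → 0ℚ ≤ W O
  0≤W O = sum-nonneg (λ i → 0≤wᴹ (O i))

  -- With `W-move`, this makes the cost of the solution so far a bound on every requested weight.
  requested≤W : ∀ O r → Satisfies O r → w (proj₁ r) ≤ W O
  requested≤W O (p , nothing) (i , Oi≡p) =
    ≤-trans (≤-reflexive (cong wᴹ (sym Oi≡p))) (term≤sum (λ i → 0≤wᴹ (O i)) i)
  requested≤W O (p , just i) Oi≡p =
    ≤-trans (≤-reflexive (cong wᴹ (sym Oi≡p))) (term≤sum (λ i → 0≤wᴹ (O i)) i)

  inv-weaken : ∀ {m m′ s} → m ≤ m′ → Inv m s → Inv m′ s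
  inv-weaken {m} {m′} {s} m≤m′ (inv ok uniq) = inv (λ j → slot (s j) (ok j)) uniq
    where
    weaken : ∀ {b} → Priced m b → Priced m′ b
    weaken (priced 0≤c c≤w w≤m) = priced 0≤c c≤w (≤-trans w≤m m≤m′)
    slot : ∀ sl → SlotOK m sl → SlotOK m′ sl
    slot (empty ▹ bs) (slotOK _ prs dbls) = slotOK tt (All.map weaken prs) dbls
    slot (gen _ _ ▹ bs) (slotOK (pr , dbl) prs dbls) = slotOK (weaken pr , dbl) (All.map weaken prs) dbls
    slot (spec _ _ ▹ bs) (slotOK pr prs dbls) = slotOK (weaken pr) (All.map weaken prs) dbls

  value-bounded : ∀ {m} sl → 0ℚ ≤ m → SlotOK m sl → value sl ≤ 12ℚ * m
  value-bounded {m} (ct ▹ bs) 0≤m (slotOK cOK prs dbls) = ≤-trans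
    (+-mono-≤ (content-bounded ct cOK) (total-≤2m 0≤m prs dbls))
    (≤-reflexive (solve 1 (λ m → con 10ℚ :* m :+ con 2ℚ :* m := con 12ℚ :* m) refl m))
    where
    10*-mono : ∀ {c} → c ≤ m → 10ℚ * c ≤ 10ℚ * m
    10*-mono {c} c≤m = ≤-by-gap (0≤* {10ℚ} 0≤10ℚ (a≤b⇒0≤b-a c≤m))
      (solve 2 (λ m c → con 10ℚ :* m :- con 10ℚ :* c := con 10ℚ :* (m :- c)) refl m c)
    credit≤m : ∀ {b} → Priced m b → proj₂ b ≤ m
    credit≤m pr = ≤-trans (Priced.bounded pr) (Priced.known pr)
    content-bounded : ∀ ct → ContentOK m (ct ▹ bs) → contentValue 10ℚ ct ≤ 10ℚ * m
    content-bounded empty _ = 0≤* {10ℚ} 0≤10ℚ 0≤m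
    content-bounded (gen p c) (pr , _) = ≤-trans (credit≤m pr)
      (≤-by-gap (0≤* {ℕtoℚ 9} (0≤ℕtoℚ 9) 0≤m)
        (solve 1 (λ m → con 10ℚ :* m :- m := con (ℕtoℚ 9) :* m) refl m))
    content-bounded (spec p c) pr = 10*-mono (credit≤m pr)

  -- `m` is the cost of the solution so far: `18ℚ * m` pays for the rises of `Ψ`, `2ℚ * W O` is the
  -- deposit still held, and the factor 4 turns a quarter of each retrieval into all of it.
  G : State → Config → ℚ → ℚ
  G s O m = 4ℚ * (V s O + K * (18ℚ * m - 2ℚ * W O))

  -- 768 = 4 * (12 + 10 * 18)
  G-bounded : ∀ {m s} O → 0ℚ ≤ m → Inv m s → G s O m ≤ 768ℚ * ℕtoℚ k * m
  G-bounded {m} {s} O 0≤m I = ≤-by-gap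
    (0≤* {4ℚ} (0≤ℕtoℚ 4) (0≤+ (0≤+ (a≤b⇒0≤b-a T-bounded)
      (0≤* 0≤K (sum-nonneg (λ j → uncovered-nonneg O j (s j) (slots I j)))))
      (0≤* 0≤K (0≤* {2ℚ} (0≤ℕtoℚ 2) (0≤W O)))))
    (solve 5 (λ n m t f x →
        con 768ℚ :* n :* m :- con 4ℚ :* (t :- con 10ℚ :* n :* f :+ con 10ℚ :* n :* (con 18ℚ :* m :- con 2ℚ :* x)) :=
        con 4ℚ :* ((n :* (con 12ℚ :* m) :- t) :+ con 10ℚ :* n :* f :+ con 10ℚ :* n :* (con 2ℚ :* x))) refl
      (ℕtoℚ k) m (T s) (Ψ s O) (W O))
    where
    T-bounded : T s ≤ ℕtoℚ k * (12ℚ * m)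
    T-bounded = ≤-trans (sum-mono (λ j → value-bounded (s j) 0≤m (slots I j))) (≤-reflexive (sum-const k (12ℚ * m)))

  V-move : ∀ {m s} O O′ → Inv m s →
    V s O + K * (18ℚ * m - 2ℚ * W O) ≤ V s O′ + K * (18ℚ * (m + stepCost O O′) - 2ℚ * W O′)
  V-move {m} {s} O O′ I = ≤-by-gap (0≤* 0≤K (a≤b⇒0≤b-a (Move.Ψ-move O O′ I)))
    (trans (factor (T s) K (Ψ s O) (Ψ s O′) (18ℚ * m - 2ℚ * W O) (18ℚ * (m + stepCost O O′) - 2ℚ * W O′))
      (cong (K *_) (regroup (Ψ s O) (Ψ s O′) m (W O) (W O′) (stepCost O O′))))
    where
    factor : ∀ t n f f′ y y′ → t - n * f′ + n * y′ - (t - n * f + n * y) ≡ n * ((y′ - y) + (f - f′))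
    factor = solve 6 (λ t n f f′ y y′ →
      t :- n :* f′ :+ n :* y′ :- (t :- n :* f :+ n :* y) := n :* ((y′ :- y) :+ (f :- f′))) refl
    regroup : ∀ f f′ m x x′ c → (18ℚ * (m + c) - 2ℚ * x′ - (18ℚ * m - 2ℚ * x)) + (f - f′) ≡
      f + (2ℚ * x + 18ℚ * c) - (f′ + 2ℚ * x′)
    regroup = solve 6 (λ f f′ m x x′ c →
      (con 18ℚ :* (m :+ c) :- con 2ℚ :* x′ :- (con 18ℚ :* m :- con 2ℚ :* x)) :+ (f :- f′) :=
      f :+ (con 2ℚ :* x :+ con 18ℚ :* c) :- (f′ :+ con 2ℚ :* x′)) refl

  -- The solution moves first, so the request is handled against the configuration `O′` that serves
  -- it.
  G-step : ∀ {m s r s′} O O′ → Handled s r s′ → Inv m s → W O ≤ m → Satisfies O′ r →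
    let m′ = m + stepCost O O′ in
    Inv m′ s′ × W O′ ≤ m′ × G s O m + stepCost (config s) (config s′) ≤ G s′ O′ m′
  G-step {m} {s} {r} {s′} O O′ handled I W≤m sat
    with handled-gain {O = O′} handled I′ sat (≤-trans (requested≤W O′ r sat) W′≤m′)
    where
    I′ : Inv (m + stepCost O O′) s
    I′ = inv-weaken (x≤x+y (sum-nonneg (λ i → slotCost-nonneg (O i) (O′ i)))) I
    W′≤m′ : W O′ ≤ m + stepCost O O′
    W′≤m′ = ≤-trans (W-move O O′) (+-monoˡ-≤ (stepCost O O′) W≤m)
  ... | I″ , gain = I″ , ≤-trans (W-move O O′) (+-monoˡ-≤ (stepCost O O′) W≤m) , ≤-by-gap
    (0≤* {4ℚ} (0≤ℕtoℚ 4) (0≤+ (a≤b⇒0≤b-a gain) (a≤b⇒0≤b-a (V-move O O′ I))))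
    (solve 5 (λ z y u v a → con 4ℚ :* (v :+ y) :- (con 4ℚ :* z :+ a) :=
        con 4ℚ :* ((v :- (u :+ con ¼ :* a)) :+ (u :+ y :- z))) refl
      (V s O + K * (18ℚ * m - 2ℚ * W O)) (K * (18ℚ * (m + stepCost O O′) - 2ℚ * W O′))
      (V s O′) (V s′ O′) (stepCost (config s) (config s′)))

  -- Telescoping of `G-step`, closed by `G-bounded` at the end of the run; `m` absorbs the cost of
  -- the part of `S` already consumed.
  run-bound : ∀ past σ S O m → Inv m (after past) → W O ≤ m → IsSolution σ S →
    G (after past) O m + costFrom (config (after past)) (runFrom landlord past σ) ≤
    768ℚ * ℕtoℚ k * (m + costFrom O S)
  run-bound past [] [] O m I W≤m [] = subst₂ _≤_ (sym (+-identityʳ (G (after past) O m)))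
    (cong (λ z → 768ℚ * ℕtoℚ k * z) (sym (+-identityʳ m))) (G-bounded O (≤-trans (0≤W O) W≤m) I)
  run-bound past (r ∷ σ) (O′ ∷ S) O m I W≤m (sat ∷ sol) = subst₂ _≤_
    (+-assoc (G (after past) O m) (stepCost (config (after past)) (config s′)) costA)
    (cong (λ z → 768ℚ * ℕtoℚ k * z) (+-assoc m (stepCost O O′) (costFrom O′ S)))
    (≤-trans (+-monoˡ-≤ costA (proj₂ (proj₂ stepped)))
      (subst (λ s → G s O′ m′ + costFrom (config s) (runFrom landlord (past ++ r ∷ []) σ) ≤
          768ℚ * ℕtoℚ k * (m′ + costFrom O′ S)) after-snoc
        (run-bound (past ++ r ∷ []) σ S O′ m′ (subst (Inv m′) (sym after-snoc) (proj₁ stepped)) (proj₁ (proj₂ stepped)) sol)))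
    where
    s′ : State
    s′ = next (after past) r
    m′ costA : ℚ
    m′ = m + stepCost O O′
    costA = costFrom (config s′) (runFrom landlord (past ++ r ∷ []) σ)
    stepped : Inv m′ s′ × W O′ ≤ m′ × G (after past) O m + stepCost (config (after past)) (config s′) ≤ G s′ O′ m′
    stepped = G-step O O′ (proj₂ (handle (after past) r)) I W≤m sat
    after-snoc : after (past ++ r ∷ []) ≡ s′
    after-snoc = foldl-++ next initial past (r ∷ [])

  initial-inv : Inv 0ℚ initial
  initial-inv = inv (λ _ → slotOK tt [] []) (λ ())

  initial-G : G initial emptyConfig 0ℚ ≡ 0ℚ
  initial-G rewrite sum-0 k =
    solve 1 (λ n → con 4ℚ :* (con 0ℚ :- n :* con 0ℚ :+ n :* (con 18ℚ :* con 0ℚ :- con 2ℚ :* con 0ℚ)) := con 0ℚ) refl K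

  landlord-competitive : Competitive (ℕtoℚ (768 ℕ.* k)) landlord
  -- The potential `G` starts at zero, so no additive constant arises.
  landlord-competitive = 0ℚ , bound
    where
    bound : ∀ σ S → IsSolution σ S → cost (run landlord σ) ≤ ℕtoℚ (768 ℕ.* k) * cost S + 0ℚ
    bound σ S sol = subst₂ _≤_
      (trans (cong (λ z → z + cost (run landlord σ)) initial-G) (+-identityˡ (cost (run landlord σ))))
      (trans (cong₂ _*_ (sym (ℕtoℚ-* 768 k)) (+-identityˡ (cost S))) (sym (+-identityʳ (ℕtoℚ (768 ℕ.* k) * cost S))))
      (run-bound [] σ S emptyConfig 0ℚ initial-inv (≤-reflexive (sum-0 k)) sol)

theorem9 : Σ ℕ λ C → ∀ (k : ℕ) → 1 ℕ.≤ k →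
    ∀ (Page : Set) (_≟_ : DecidableEquality Page) (w : Page → ℚ) →
    (∀ p → 0ℚ ≤ w p) →
    ∃ λ (A : AllOrOne.OnlineAlg Page _≟_ w k) →
      AllOrOne.Competitive Page _≟_ w k (ℕtoℚ (C ℕ.* k)) A
theorem9 = 768 , λ k 1≤k Page _≟_ w 0≤w →
  Landlord.landlord Page _≟_ w k 1≤k , Analysis.landlord-competitive Page _≟_ w 0≤w k 1≤k
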